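{- There exists a function $f \colon \mathbb N \to \mathbb N$ such that the following holds. Let $G$ be a connected graph with disjoint vertex sets $S, T \subseteq V(G)$. Suppose that any minimum feedback vertex set $X$ of $G$ misses some vertex from $S$ (i.e. $S \not\subseteq X$) or leaves two vertices from $T$ connected in $G - X$. Then there exist sets $S^* \subseteq S$ and $T^* \subseteq T$ with $|S^*|, |T^*| \le f(\mathrm{ed}_{\mathcal G_F}(G))$ such that any minimum feedback vertex set $X$ of $G$ misses some vertex from $S^*$ or leaves two vertices from $T^*$ connected in $G - X$.
   Context: All graphs are finite, undirected and simple. A feedback vertex set of $G$ is a set $X \subseteq V(G)$ such that $G - X$ is acyclic; it is minimum if it has the smallest possible size. A set $X$ leaves two vertices from $T$ connected in $G - X$ if two distinct vertices of $T \setminus X$ lie in the same connected component of $G - X$. $\mathcal G_F$ is the family of all forests. The elimination distance to a forest is defined as follows, where $\mathrm{cc}(G)$ is the set of connected components of $G$: $\mathrm{ed}_{\mathcal G_F}(G) = 0$ if $G$ is a forest; otherwise $\mathrm{ed}_{\mathcal G_F}(G) = \max_{G' \in \mathrm{cc}(G)} \mathrm{ed}_{\mathcal G_F}(G')$ if $|\mathrm{cc}(G)| > 1$; and otherwise $\mathrm{ed}_{\mathcal G_F}(G) = 1 + \min_{v \in V(G)} \mathrm{ed}_{\mathcal G_F}(G - \{v\})$. -}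

module Defs where

open import Data.Empty using (⊥-elim)
open import Data.Fin using (Fin; suc; _≟_)
open import Data.Fin.Properties using (any?)
open import Data.Fin.Subset using (Subset; _∈_; _∉_; _⊆_; _⊈_; _⊂_; ∁; _─_; _-_; ∣_∣; Nonempty)
open import Data.Fin.Subset.Induction using (Acc; acc; ⊂-wellFounded)
open import Data.Fin.Subset.Properties using (_∈?_; ⊆-antisym; x∈p⇒p-x⊂p; x∈p⇒∣p-x∣<∣p∣; x∈p∧x≢y⇒x∈p-y; p─q⊆p)
open import Data.List using (List; []; _∷_; _∷ʳ_; length; map; foldr; filter; deduplicate; allFin)
open import Data.List.Membership.Propositional using (mapWith∈) renaming (_∈_ to _∈ˡ_)
open import Data.List.Membership.Propositional.Properties using (mapWith∈-cong; mapWith∈≗map; ∈-map⁺; ∈-map⁻; ∈-filter⁺; ∈-filter⁻; ∈-allFin; ∈-deduplicate⁺; ∈-deduplicate⁻)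
open import Data.List.Relation.Unary.All using (All; []; _∷_; all?)
import Data.List.Relation.Unary.All as All
open import Data.List.Relation.Unary.AllPairs using (_∷_)
open import Data.List.Relation.Unary.Any using (here; there)
open import Data.List.Relation.Unary.Linked using (Linked; linked?)
open import Data.List.Relation.Unary.Unique.Propositional using (Unique)
open import Data.List.Relation.Unary.Unique.DecPropositional using (unique?)
open import Data.List.Relation.Unary.Unique.DecPropositional.Properties using (deduplicate-!)
open import Data.Nat using (ℕ; zero; suc; _≤_; _<_; z≤n; s≤s; s≤s⁻¹; _⊔_; _⊓_)
import Data.Nat as ℕ
open import Data.Nat.Properties using (≤-trans; <⇒≤)
open import Data.Product using (∃-syntax; _×_; _,_; proj₁; proj₂)
open import Data.Sum using (_⊎_; inj₁; inj₂)
open import Data.Vec using (tabulate; _∷_; there)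
open import Data.Vec.Properties using (≡-dec; lookup∘tabulate; []=⇒lookup; lookup⇒[]=)
import Data.Bool as Bool
open import Level using (0ℓ)
open import Relation.Binary using (Rel; Decidable; Symmetric)
open import Relation.Binary.Construct.Closure.ReflexiveTransitive using (Star; ε; _◅_; _◅◅_; reverse; gmap)
open import Relation.Binary.PropositionalEquality using (_≡_; _≢_; refl; sym; trans; cong)
open import Relation.Nullary using (Dec; yes; no; does; ¬_; ¬?; _×-dec_; contradiction)
open import Relation.Nullary.Decidable using (map′; dec-true)
import Relation.Unary as U

-- A finite simple undirected graph with vertex set Fin n.

record Graph (n : ℕ) : Set₁ where
  field
    Adj     : Rel (Fin n) 0ℓ
    adj?    : Decidable Adj
    adj-sym : Symmetric Adj
    irrefl  : ∀ {v} → ¬ Adj v v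

maximum : List ℕ → ℕ
maximum = foldr _⊔_ 0

-- The value on [] is junk: the list is nonempty wherever it matters.
minimum : List ℕ → ℕ
minimum []       = 0
minimum (x ∷ xs) = foldr _⊓_ x xs

elements : ∀ {n} → Subset n → List (Fin n)
elements A = filter (_∈? A) (allFin _)

x∉p-x : ∀ {n} (p : Subset n) {x} → x ∉ p - x
x∉p-x (_ ∷ p) {suc x} (there x∈) = x∉p-x p x∈

anyList? : ∀ {n} {P : U.Pred (List (Fin n)) 0ℓ} → U.Decidable P →
           ∀ k → Dec (∃[ vs ] (length vs ≤ k × P vs))
anyList? P? zero = map′ (λ p → [] , z≤n , p) (λ { ([] , _ , p) → p }) (P? [])
anyList? P? (suc k) with P? []
... | yes p = yes ([] , z≤n , p)
... | no ¬p =
  map′ (λ (v , vs , l , p) → v ∷ vs , s≤s l , p)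
       (λ { ([] , _ , p) → contradiction p ¬p ; (v ∷ vs , s≤s l , p) → v , vs , l , p })
       (any? λ v → anyList? (λ vs → P? (v ∷ vs)) k)

Unique⇒length≤ : ∀ {n} {A : Subset n} {vs} → All (_∈ A) vs → Unique vs → length vs ≤ ∣ A ∣
Unique⇒length≤ [] _ = z≤n
Unique⇒length≤ (v∈A ∷ vs∈A) (v∉vs ∷ u) =
  ≤-trans (s≤s (Unique⇒length≤ (All.zipWith (λ (x∈A , v≢x) → x∈p∧x≢y⇒x∈p-y x∈A (λ e → v≢x (sym e))) (vs∈A , v∉vs)) u))
          (x∈p⇒∣p-x∣<∣p∣ v∈A)

∈-elements⁺ : ∀ {n} {A : Subset n} {v} → v ∈ A → v ∈ˡ elements A
∈-elements⁺ {A = A} v∈A = ∈-filter⁺ (_∈? A) (∈-allFin _) v∈A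

∈-elements⁻ : ∀ {n} {A : Subset n} {v} → v ∈ˡ elements A → v ∈ A
∈-elements⁻ {A = A} v∈ = proj₂ (∈-filter⁻ (_∈? A) {xs = allFin _} v∈)

another : ∀ {a} {B : Set a} {x : B} xs → Unique xs → 1 < length xs → x ∈ˡ xs →
          ∃[ y ] (y ∈ˡ xs × x ≢ y)
another (y ∷ z ∷ _) ((y≢z ∷ _) ∷ _) _ (here refl) = z , there (here refl) , y≢z
another (y ∷ zs) (y∉zs ∷ _) _ (there x∈) =
  y , here refl , λ e → All.lookup y∉zs x∈ (sym e)
another (_ ∷ []) _ (s≤s ()) (here _)

⊈⇒∃ : ∀ {n} {A C : Subset n} → A ⊈ C → ∃[ x ] (x ∈ A × x ∉ C)
⊈⇒∃ {A = A} {C} A⊈C with any? (λ x → (x ∈? A) ×-dec ¬? (x ∈? C))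
... | yes r = r
... | no ¬r = ⊥-elim (A⊈C sub)
  where
  sub : A ⊆ C
  sub {x} x∈A with x ∈? C
  ... | yes x∈C = x∈C
  ... | no x∉C  = ⊥-elim (¬r (x , x∈A , x∉C))

-- All graphs obtained from G by taking components and deleting vertices are
-- induced subgraphs, so each is represented by its vertex set A and a notion
-- for "G[A]" takes the argument A.  In particular G is A = ⊤ and G - X is
-- A = ∁ X.

module _ {n : ℕ} (G : Graph n) where

  open Graph G

  AdjIn : Subset n → Rel (Fin n) 0ℓ
  AdjIn A u v = u ∈ A × v ∈ A × Adj u v

  Joined : Subset n → Rel (Fin n) 0ℓ
  Joined A u v = u ∈ A × v ∈ A × Star (AdjIn A) u v

  Connected : Subset n → Set
  Connected A = Nonempty A × (∀ {u v} → u ∈ A → v ∈ A → Joined A u v)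

  -- v , vs lists the distinct vertices of the cycle in order; the appended v
  -- closes it.
  IsCycle : Subset n → Fin n → List (Fin n) → Set
  IsCycle A v vs =
    2 ≤ length vs × All (_∈ A) (v ∷ vs) × Unique (v ∷ vs) × Linked Adj (v ∷ vs ∷ʳ v)

  Forest : Subset n → Set
  Forest A = ¬ (∃[ v ] ∃[ vs ] IsCycle A v vs)

  IsFVS : Subset n → Set
  IsFVS X = Forest (∁ X)

  IsMinFVS : Subset n → Set
  IsMinFVS X = IsFVS X × (∀ Y → IsFVS Y → ∣ X ∣ ≤ ∣ Y ∣)

  LeavesConnected : Subset n → Subset n → Set
  LeavesConnected X T =
    ∃[ u ] ∃[ v ] (u ∈ T ─ X × v ∈ T ─ X × u ≢ v × Joined (∁ X) u v)

  Joined-refl : ∀ {A v} → v ∈ A → Joined A v v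
  Joined-refl v∈A = v∈A , v∈A , ε

  Joined-sym : ∀ {A u v} → Joined A u v → Joined A v u
  Joined-sym (u∈A , v∈A , p) =
    v∈A , u∈A , reverse (λ (x∈A , y∈A , a) → y∈A , x∈A , adj-sym a) p

  Joined-trans : ∀ {A u v w} → Joined A u v → Joined A v w → Joined A u w
  Joined-trans (u∈A , _ , p) (_ , w∈A , q) = u∈A , w∈A , p ◅◅ q

  -- The part of a walk after its last visit to u avoids u.
  avoid : ∀ {A u w v} → w ∈ A → v ≢ u → Star (AdjIn A) w v →
          Joined (A - u) w v ⊎ ∃[ w′ ] (Adj u w′ × Joined (A - u) w′ v)
  avoid w∈A v≢u ε = inj₁ (Joined-refl (x∈p∧x≢y⇒x∈p-y w∈A v≢u))
  avoid {u = u} {w = w} w∈A v≢u ((_ , x∈A , a) ◅ p) with avoid x∈A v≢u p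
  ... | inj₂ r = inj₂ r
  ... | inj₁ j@(x∈A-u , v∈A-u , q) with w ≟ u
  ...   | yes refl = inj₂ (_ , a , j)
  ...   | no w≢u   =
    let w∈A-u = x∈p∧x≢y⇒x∈p-y w∈A w≢u
    in inj₁ (w∈A-u , v∈A-u , (w∈A-u , x∈A-u , a) ◅ q)

  Joined-step : ∀ {A u v w} → u ∈ A → Adj u w → Joined (A - u) w v → Joined A u v
  Joined-step {A} {u} u∈A a (w∈ , v∈ , p) =
    u∈A , up v∈ , (u∈A , up w∈ , a) ◅ gmap (λ x → x) (λ (x∈ , y∈ , b) → up x∈ , up y∈ , b) p
    where
    up : A - u ⊆ A
    up = p─q⊆p A _

  joined-acc? : ∀ A → Acc _⊂_ A → Decidable (Joined A)
  joined-acc? A (acc rs) u v with u ∈? A | v ∈? A | v ≟ u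
  ... | no u∉A  | _       | _        = no λ (u∈A , _) → u∉A u∈A
  ... | yes _   | no v∉A  | _        = no λ (_ , v∈A , _) → v∉A v∈A
  ... | yes u∈A | yes _   | yes refl = yes (Joined-refl u∈A)
  ... | yes u∈A | yes v∈A | no v≢u   =
    map′ (λ (_ , a , j) → Joined-step u∈A a j) last-exit
         (any? λ w → adj? u w ×-dec joined-acc? (A - u) (rs (x∈p⇒p-x⊂p u∈A)) w v)
    where
    last-exit : Joined A u v → ∃[ w ] (Adj u w × Joined (A - u) w v)
    last-exit (_ , _ , p) with avoid u∈A v≢u p
    ... | inj₁ (u∈A-u , _) = contradiction u∈A-u (x∉p-x A)
    ... | inj₂ r           = r

  joined? : ∀ A → Decidable (Joined A)
  joined? A = joined-acc? A (⊂-wellFounded A)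

  isCycle? : ∀ A v vs → Dec (IsCycle A v vs)
  isCycle? A v vs =
    (2 ℕ.≤? length vs) ×-dec all? (_∈? A) (v ∷ vs) ×-dec unique? _≟_ (v ∷ vs)
      ×-dec linked? adj? (v ∷ vs ∷ʳ v)

  forest? : ∀ A → Dec (Forest A)
  forest? A = ¬? (any? λ v →
    map′ (λ (vs , _ , c) → vs , c)
         (λ { (vs , c@(_ , in-A , u , _)) → vs , <⇒≤ (Unique⇒length≤ in-A u) , c })
         (anyList? (isCycle? A v) ∣ A ∣))

  component : Subset n → Fin n → Subset n
  component A v = tabulate λ w → does (joined? A v w)

  cc : Subset n → List (Subset n)
  cc A = deduplicate (≡-dec Bool._≟_) (map (component A) (elements A))

  ∈-component⁺ : ∀ {A v w} → Joined A v w → w ∈ component A v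
  ∈-component⁺ {A} {v} {w} j =
    lookup⇒[]= w _ (trans (lookup∘tabulate _ w) (dec-true (joined? A v w) j))

  ∈-component⁻ : ∀ {A v w} → w ∈ component A v → Joined A v w
  ∈-component⁻ {A} {v} {w} w∈ with joined? A v w | trans (sym (lookup∘tabulate (λ x → does (joined? A v x)) w)) ([]=⇒lookup w∈)
  ... | yes j | _ = j

  component-cong : ∀ {A v w} → Joined A v w → component A v ≡ component A w
  component-cong j = ⊆-antisym
    (λ x∈ → ∈-component⁺ (Joined-trans (Joined-sym j) (∈-component⁻ x∈)))
    (λ x∈ → ∈-component⁺ (Joined-trans j (∈-component⁻ x∈)))

  ∈-cc⁺ : ∀ {A v} → v ∈ A → component A v ∈ˡ cc A
  ∈-cc⁺ {A} v∈A = ∈-deduplicate⁺ (≡-dec Bool._≟_) (∈-map⁺ (component A) (∈-elements⁺ v∈A))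

  ∈-cc⁻ : ∀ {A C} → C ∈ˡ cc A → ∃[ v ] (v ∈ A × C ≡ component A v)
  ∈-cc⁻ {A} C∈ with ∈-map⁻ (component A) (∈-deduplicate⁻ (≡-dec Bool._≟_) (map (component A) (elements A)) C∈)
  ... | v , v∈ , eq = v , ∈-elements⁻ v∈ , eq

  full-component-unique : ∀ {A C D} → C ∈ˡ cc A → D ∈ˡ cc A → A ⊆ C → C ≡ D
  full-component-unique C∈ D∈ A⊆C with ∈-cc⁻ C∈ | ∈-cc⁻ D∈
  ... | v , _ , refl | w , w∈A , refl = component-cong (∈-component⁻ {v = v} (A⊆C w∈A))

  cc-⊂ : ∀ {A C} → 1 < length (cc A) → C ∈ˡ cc A → C ⊂ A
  cc-⊂ {A} {C} 1< C∈ = C⊆A C∈ , ⊈⇒∃ A⊈C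
    where
    C⊆A : C ∈ˡ cc A → C ⊆ A
    C⊆A C∈ x∈C with ∈-cc⁻ C∈
    ... | v , _ , refl = proj₁ (proj₂ (∈-component⁻ {v = v} x∈C))

    A⊈C : A ⊈ C
    A⊈C A⊆C with another (cc A) (deduplicate-! (≡-dec Bool._≟_) (map (component A) (elements A))) 1< C∈
    ... | _ , D∈ , C≢D = C≢D (full-component-unique C∈ D∈ A⊆C)

  ed-acc : ∀ A → Acc _⊂_ A → ℕ
  ed-acc A (acc rs) with forest? A
  ... | yes _ = 0
  ... | no _ with 1 ℕ.<? length (cc A)
  ...   | yes 1< = maximum (mapWith∈ (cc A) λ {C} C∈ → ed-acc C (rs (cc-⊂ 1< C∈)))
  ...   | no _   = suc (minimum (mapWith∈ (elements A) λ {v} v∈ →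
                     ed-acc (A - v) (rs (x∈p⇒p-x⊂p (∈-elements⁻ v∈)))))

  -- The elimination distance of G[A] to a forest, characterised by
  -- ed-forest, ed-disconnected and ed-connected below.
  ed : Subset n → ℕ
  ed A = ed-acc A (⊂-wellFounded A)

  ed-acc-irrelevant : ∀ A (a b : Acc _⊂_ A) → ed-acc A a ≡ ed-acc A b
  ed-acc-irrelevant A (acc rs) (acc rs′) with forest? A
  ... | yes _ = refl
  ... | no _ with 1 ℕ.<? length (cc A)
  ...   | yes 1< = cong maximum (mapWith∈-cong (cc A) _ _ λ C∈ →
                     ed-acc-irrelevant _ (rs (cc-⊂ 1< C∈)) (rs′ (cc-⊂ 1< C∈)))
  ...   | no _   = cong (λ ks → suc (minimum ks)) (mapWith∈-cong (elements A) _ _ λ v∈ →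
                     ed-acc-irrelevant _ (rs (x∈p⇒p-x⊂p (∈-elements⁻ v∈))) (rs′ (x∈p⇒p-x⊂p (∈-elements⁻ v∈))))

  ed-acc-forest : ∀ {A} (a : Acc _⊂_ A) → Forest A → ed-acc A a ≡ 0
  ed-acc-forest {A} (acc _) F with forest? A
  ... | yes _ = refl
  ... | no ¬F = contradiction F ¬F

  ed-acc-disconnected : ∀ {A} (a : Acc _⊂_ A) → ¬ Forest A → 1 < length (cc A) →
                        ed-acc A a ≡ maximum (map ed (cc A))
  ed-acc-disconnected {A} (acc rs) ¬F 1<cc with forest? A
  ... | yes F = contradiction F ¬F
  ... | no _ with 1 ℕ.<? length (cc A)
  ...   | no ≮   = contradiction 1<cc ≮
  ...   | yes 1< = cong maximum (trans
            (mapWith∈-cong (cc A) _ _ λ C∈ → ed-acc-irrelevant _ (rs (cc-⊂ 1< C∈)) (⊂-wellFounded _))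
            (mapWith∈≗map ed (cc A)))

  ed-acc-connected : ∀ {A} (a : Acc _⊂_ A) → ¬ Forest A → ¬ 1 < length (cc A) →
                     ed-acc A a ≡ suc (minimum (map (λ v → ed (A - v)) (elements A)))
  ed-acc-connected {A} (acc rs) ¬F ≮cc with forest? A
  ... | yes F = contradiction F ¬F
  ... | no _ with 1 ℕ.<? length (cc A)
  ...   | yes 1< = contradiction 1< ≮cc
  ...   | no _   = cong (λ ks → suc (minimum ks)) (trans
            (mapWith∈-cong (elements A) _ _ λ v∈ →
              ed-acc-irrelevant _ (rs (x∈p⇒p-x⊂p (∈-elements⁻ v∈))) (⊂-wellFounded _))
            (mapWith∈≗map (λ v → ed (A - v)) (elements A)))

  ed-forest : ∀ {A} → Forest A → ed A ≡ 0
  ed-forest {A} = ed-acc-forest (⊂-wellFounded A)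

  ed-disconnected : ∀ {A} → ¬ Forest A → 1 < length (cc A) → ed A ≡ maximum (map ed (cc A))
  ed-disconnected {A} = ed-acc-disconnected (⊂-wellFounded A)

  ed-connected : ∀ {A} → ¬ Forest A → ¬ 1 < length (cc A) →
                 ed A ≡ suc (minimum (map (λ v → ed (A - v)) (elements A)))
  ed-connected {A} = ed-acc-connected (⊂-wellFounded A)

{-# OPTIONS --safe #-}

-- Represent a feedback vertex set X by its complement W, and join an additional
-- vertex to all vertices of T: then X contains S and separates T iff W avoids S
-- and W together with the additional vertex induces a forest.  The labels (S , T)
-- of a piece C of the graph are replaced by a bounded part of them such that a
-- near-optimal W for the reduced labels can be traded, in every context, for one
-- of at least the same size for the full labels.  A context is a bounded set K of
-- kept vertices together with the connectivity between them outside of C.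
--
-- Deleting a vertex v from C: v is either deleted or moved to K, at the price of
-- one more unit of slack, so the labels for these two cases and of v suffice.
--
-- Components: a component is good if it has an optimal solution that leaves K
-- pairwise separated; good components need no labels.  In any solution a bad
-- component costs one unit of slack or merges two classes of K, so the labels of
-- b + k + 1 bad components already cannot be satisfied.
--
-- Forests: either the forest contains b + 1 disjoint subtrees with two vertices
-- of T each, whose labels cannot be satisfied, or b vertices separate T (cut off
-- a lowest subtree with two vertices of T at its root and repeat).  Deleting
-- these leaves components with at most one vertex of T each.
module Submission where

open import Defs
import Data.Bool as Bool
open import Data.Empty using (⊥-elim) renaming (⊥ to ⊥′)
open import Data.Fin using (Fin; zero; suc; _≟_) renaming (_<_ to _<ᶠ_)
import Data.Fin as Fin
import Data.Fin.Properties as Fin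
open import Data.Fin.Properties using (any?; suc-injective)
open import Data.Fin.Subset using (Subset; _∈_; _∉_; _⊆_; _⊈_; _⊂_; _∩_; _∪_; _─_; _-_; ∁; ⁅_⁆; ⊤; ⊥; ∣_∣; Empty; inside; outside)
open import Data.Fin.Subset.Induction using (Acc; acc; ⊂-wellFounded)
open import Data.Fin.Subset.Properties
open import Data.List using (List; []; _∷_; _∷ʳ_; _++_; length; map; foldl; filter; take; allFin; cartesianProduct)
import Data.List.Membership.DecPropositional as DecMembership
open import Data.List.Membership.Propositional using () renaming (_∈_ to _∈ˡ_)
open import Data.List.Membership.Propositional.Properties
open import Data.List.Properties using (foldl-++; length-map; length-take; take++drop≡id)
open import Data.List.Relation.Binary.Permutation.Propositional using (_↭_; ↭-sym)
import Data.List.Relation.Binary.Permutation.Propositional as ↭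
open import Data.List.Relation.Binary.Permutation.Propositional.Properties using (shift; ++-comm; ∈-resp-↭)
open import Data.List.Relation.Binary.Subset.Propositional using () renaming (_⊆_ to _⊆ˡ_)
open import Data.List.Relation.Unary.All using (All; []; _∷_)
import Data.List.Relation.Unary.All as All
open import Data.List.Relation.Unary.All.Properties using (¬Any⇒All¬)
open import Data.List.Relation.Unary.AllPairs using (AllPairs; []; _∷_)
import Data.List.Relation.Unary.AllPairs.Properties as AllPairs
open import Data.List.Relation.Unary.Any using (here; there)
open import Data.List.Relation.Unary.Linked using (Linked; []; [-]; _∷_)
open import Data.List.Relation.Unary.Unique.DecPropositional.Properties using (deduplicate-!)
open import Data.List.Relation.Unary.Unique.Propositional using (Unique)
import Data.List.Relation.Unary.Unique.Propositional.Properties as Unique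
open import Data.Nat using (ℕ; zero; suc; _+_; _*_; _≤_; _<_; z≤n; s≤s)
import Data.Nat as ℕ
import Data.Nat.Properties as ℕ
open import Data.Product using (Σ-syntax; ∃-syntax; _×_; _,_; proj₁; proj₂)
open import Data.Sum using (_⊎_; inj₁; inj₂; [_,_]′) renaming (swap to swap⊎)
open import Data.Unit using () renaming (⊤ to ⊤′)
open import Data.Vec using ([]; _∷_; here; there)
open import Data.Vec.Properties using (≡-dec)
open import Function using (id)
open import Level using (0ℓ)
open import Relation.Binary using (Rel; IsEquivalence; tri<; tri≈; tri>)
open import Relation.Binary.Construct.Closure.ReflexiveTransitive using (Star; ε; _◅_; _◅◅_; reverse; gmap)
open import Relation.Binary.PropositionalEquality using (_≡_; _≢_; refl; sym; trans; cong; subst; subst₂)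
open import Relation.Nullary using (Dec; yes; no; ¬_; ¬?; _×-dec_; _⊎-dec_; contradiction)
open import Relation.Nullary.Decidable using (map′)
open import Relation.Unary using (Pred)
import Relation.Unary as U

private variable
  m n : ℕ

-- Partitions of the vertex set and merging along edges

Edge : ℕ → Set
Edge m = Fin m × Fin m

-- An equivalence relation on Fin m, given by its classes u ~ v :⇔ c u ≡ c v.
Colouring : ℕ → Set
Colouring m = Fin m → Fin m

private variable
  b c d : Colouring m
  e     : Edge m
  es fs : List (Edge m)

_⊑[_]_ : Colouring m → Pred (Fin m) 0ℓ → Colouring m → Set
c ⊑[ U ] d = ∀ {u v} → U u → U v → c u ≡ c v → d u ≡ d v

record _⊑_ (c d : Colouring m) : Set where
  constructor ⊑⁺
  field ⊑⁻ : ∀ {u v} → c u ≡ c v → d u ≡ d v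
open _⊑_

⊑-refl : c ⊑ c
⊑-refl = ⊑⁺ λ eq → eq

⊑-trans : b ⊑ c → c ⊑ d → b ⊑ d
⊑-trans p q = ⊑⁺ λ eq → ⊑⁻ q (⊑⁻ p eq)

merge : Colouring m → Edge m → Colouring m
merge c (x , y) w with c w ≟ c x
... | yes _ = c y
... | no _  = c w

merge-⊑ : ∀ (c : Colouring m) e → c ⊑ merge c e
merge-⊑ c (x , y) = ⊑⁺ λ {u} {v} → go u v
  where
  go : ∀ u v → c u ≡ c v → merge c (x , y) u ≡ merge c (x , y) v
  go u v eq with c u ≟ c x | c v ≟ c x
  ... | yes _ | yes _ = refl
  ... | yes p | no q  = contradiction (trans (sym eq) p) q
  ... | no p  | yes q = contradiction (trans eq q) p
  ... | no _  | no _  = eq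

merge-joins : ∀ (c : Colouring m) ((x , y) : Edge m) → merge c (x , y) x ≡ merge c (x , y) y
merge-joins c (x , y) with c x ≟ c x | c y ≟ c x
... | yes _ | yes _ = refl
... | yes _ | no _  = refl
... | no q  | _     = contradiction refl q

merge-⁻ : ∀ (c : Colouring m) ((x , y) : Edge m) {u v} → merge c (x , y) u ≡ merge c (x , y) v →
          c u ≡ c v ⊎ (c u ≡ c x × c v ≡ c y) ⊎ (c u ≡ c y × c v ≡ c x)
merge-⁻ c (x , y) {u} {v} eq with c u ≟ c x | c v ≟ c x
... | yes p | yes q = inj₁ (trans p (sym q))
... | yes p | no _  = inj₂ (inj₁ (p , sym eq))
... | no _  | yes q = inj₂ (inj₂ (eq , q))
... | no _  | no _  = inj₁ eq

mergeAll : Colouring m → List (Edge m) → Colouring m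
mergeAll = foldl merge

mergeAll-++ : ∀ (c : Colouring m) es fs → mergeAll c (es ++ fs) ≡ mergeAll (mergeAll c es) fs
mergeAll-++ c es fs = foldl-++ merge c es fs

mergeAll-⊑ : ∀ (c : Colouring m) es → c ⊑ mergeAll c es
mergeAll-⊑ c []       = ⊑-refl
mergeAll-⊑ c (e ∷ es) = ⊑-trans (merge-⊑ c e) (mergeAll-⊑ (merge c e) es)

mergeAll-joins : ∀ (c : Colouring m) {x y} → (x , y) ∈ˡ es → mergeAll c es x ≡ mergeAll c es y
mergeAll-joins {es = e ∷ es} c (here refl) = ⊑⁻ (mergeAll-⊑ (merge c e) es) (merge-joins c e)
mergeAll-joins {es = e ∷ _}  c (there e∈)  = mergeAll-joins (merge c e) e∈

-- Universal property of the generated equivalence. `R` is an arbitrary equivalence relation and not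
-- a colouring, because it is instantiated with reachability by walks and with invariants of
-- merging.
mergeAll-least : ∀ {R : Rel (Fin m) 0ℓ} → IsEquivalence R → (∀ {u v} → c u ≡ c v → R u v) →
                 (∀ {x y} → (x , y) ∈ˡ es → R x y) →
                 ∀ {u v} → mergeAll c es u ≡ mergeAll c es v → R u v
mergeAll-least {es = []} _ base _ eq = base eq
mergeAll-least {c = c} {es = (x , y) ∷ es} {R} equiv base joins =
  mergeAll-least equiv step (λ e∈ → joins (there e∈))
  where
  module R = IsEquivalence equiv
  step : ∀ {u v} → merge c (x , y) u ≡ merge c (x , y) v → R u v
  step eq with merge-⁻ c (x , y) eq
  ... | inj₁ p              = base p
  ... | inj₂ (inj₁ (p , q)) = R.trans (base p) (R.trans (joins (here refl)) (R.sym (base q)))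
  ... | inj₂ (inj₂ (p , q)) = R.trans (base p) (R.trans (R.sym (joins (here refl))) (R.sym (base q)))

mergeAll-least-⊑ : c ⊑ d → (∀ {x y} → (x , y) ∈ˡ es → d x ≡ d y) → mergeAll c es ⊑ d
mergeAll-least-⊑ c⊑d joins =
  ⊑⁺ (mergeAll-least record { refl = refl ; sym = sym ; trans = trans } (⊑⁻ c⊑d) joins)

mergeAll-mono : c ⊑ d → es ⊆ˡ fs → mergeAll c es ⊑ mergeAll d fs
mergeAll-mono {d = d} {fs = fs} c⊑d es⊆fs =
  mergeAll-least-⊑ (⊑-trans c⊑d (mergeAll-⊑ d fs)) (λ e∈ → mergeAll-joins d (es⊆fs e∈))

-- Independent edge lists: the graphic matroid over a partition

-- The edges of es join distinct classes one after the other: adding es to a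
-- forest whose components are the classes of c creates no cycle.
data Indep (c : Colouring m) : List (Edge m) → Set where
  []  : Indep c []
  _∷_ : ∀ {x y es} → c x ≢ c y → Indep (merge c (x , y)) es → Indep c ((x , y) ∷ es)

indep? : ∀ (c : Colouring m) es → Dec (Indep c es)
indep? c [] = yes []
indep? c ((x , y) ∷ es) =
  map′ (λ (p , q) → p ∷ q) (λ { (p ∷ q) → p , q }) (¬? (c x ≟ c y) ×-dec indep? (merge c (x , y)) es)

merge-mono-on : ∀ {U : Pred (Fin m) 0ℓ} {x y} → U x → U y →
                c ⊑[ U ] d → merge c (x , y) ⊑[ U ] merge d (x , y)
merge-mono-on {c = c} {d = d} {x = x} {y} Ux Uy c⊑d Uu Uv eq with merge-⁻ c (x , y) eq
... | inj₁ p              = ⊑⁻ (merge-⊑ d _) (c⊑d Uu Uv p)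
... | inj₂ (inj₁ (p , q)) =
  trans (⊑⁻ (merge-⊑ d _) (c⊑d Uu Ux p)) (trans (merge-joins d _) (sym (⊑⁻ (merge-⊑ d _) (c⊑d Uv Uy q))))
... | inj₂ (inj₂ (p , q)) =
  trans (⊑⁻ (merge-⊑ d _) (c⊑d Uu Uy p)) (trans (sym (merge-joins d _)) (sym (⊑⁻ (merge-⊑ d _) (c⊑d Uv Ux q))))

-- Edges with both ends in `U` see only the classes inside `U`, so comparing the two partitions
-- there suffices.
Indep-anti-on : ∀ {U : Pred (Fin m) 0ℓ} → (∀ {x y} → (x , y) ∈ˡ es → U x × U y) →
                c ⊑[ U ] d → Indep d es → Indep c es
Indep-anti-on _ _ [] = []
Indep-anti-on inU c⊑d (p ∷ ps) with Ux , Uy ← inU (here refl) =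
  (λ eq → p (c⊑d Ux Uy eq)) ∷ Indep-anti-on (λ e∈ → inU (there e∈)) (merge-mono-on Ux Uy c⊑d) ps

Indep-anti : c ⊑ d → Indep d es → Indep c es
Indep-anti c⊑d = Indep-anti-on {U = λ _ → ⊤′} _ (λ _ _ → ⊑⁻ c⊑d)

Indep-++⁺ : Indep c es → Indep (mergeAll c es) fs → Indep c (es ++ fs)
Indep-++⁺ []       qs = qs
Indep-++⁺ (p ∷ ps) qs = p ∷ Indep-++⁺ ps qs

Indep-++⁻ : ∀ es → Indep c (es ++ fs) → Indep c es × Indep (mergeAll c es) fs
Indep-++⁻ []       ps       = [] , ps
Indep-++⁻ (_ ∷ es) (p ∷ ps) with qs , rs ← Indep-++⁻ es ps = p ∷ qs , rs

-- If `e` closed a cycle after `f`, that cycle would run through `f`, and then `f` would close it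
-- after `e`.
Indep-swap : ∀ {e f} → Indep c (e ∷ f ∷ es) → Indep c (f ∷ e ∷ es)
Indep-swap {c = c} {e = e@(x , y)} {f@(u , v)} (p ∷ q ∷ r) =
  (λ eq → q (⊑⁻ (merge-⊑ c e) eq)) ∷ p′ ∷ Indep-anti commute r
  where
  commute : merge (merge c f) e ⊑ merge (merge c e) f
  commute = mergeAll-mono {c = c} {es = f ∷ e ∷ []} {fs = e ∷ f ∷ []} ⊑-refl
    λ { (here x) → there (here x) ; (there (here x)) → here x }

  p′ : merge c f x ≢ merge c f y
  p′ eq with merge-⁻ c f eq
  ... | inj₁ z = p z
  ... | inj₂ (inj₁ (z , w)) = q (trans (sym (⊑⁻ (merge-⊑ c e) z)) (trans (merge-joins c e) (⊑⁻ (merge-⊑ c e) w)))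
  ... | inj₂ (inj₂ (z , w)) = q (trans (sym (⊑⁻ (merge-⊑ c e) w)) (trans (sym (merge-joins c e)) (⊑⁻ (merge-⊑ c e) z)))

Indep-↭ : es ↭ fs → Indep c es → Indep c fs
Indep-↭ ↭.refl           ps       = ps
Indep-↭ (↭.prep _ σ)     (p ∷ ps) = p ∷ Indep-↭ σ ps
Indep-↭ (↭.swap _ _ σ)   ps with Indep-swap ps
... | p ∷ q ∷ r = p ∷ q ∷ Indep-↭ σ r
Indep-↭ (↭.trans σ τ)    ps       = Indep-↭ τ (Indep-↭ σ ps)

Indep-++-comm : ∀ es → Indep c (es ++ fs) → Indep c (fs ++ es)
Indep-++-comm {fs = fs} es = Indep-↭ (++-comm es fs)

-- By permutation invariance any edge can be put last, where independence says that the remaining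
-- edges `fs` leave its ends in different classes.
Indep-bridge : ∀ {x y} → Indep c es → (x , y) ∈ˡ es →
               ∃[ fs ] ((∀ {f} → f ∈ˡ es → f ≡ (x , y) ⊎ f ∈ˡ fs) × mergeAll c fs x ≢ mergeAll c fs y)
Indep-bridge {c = c} {x = x} {y} ps e∈ with ∈-∃++ e∈
... | xs , ys , refl = xs ++ ys , others , bridge (proj₂ (Indep-++⁻ (xs ++ ys) (Indep-↭ σ ps)))
  where
  σ : xs ++ (x , y) ∷ ys ↭ (xs ++ ys) ++ (x , y) ∷ []
  σ = ↭.trans (shift (x , y) xs ys) (++-comm ((x , y) ∷ []) (xs ++ ys))

  others : ∀ {f} → f ∈ˡ xs ++ (x , y) ∷ ys → f ≡ (x , y) ⊎ f ∈ˡ xs ++ ys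
  others f∈ with ∈-resp-↭ (shift (x , y) xs ys) f∈
  ... | here eq  = inj₁ eq
  ... | there f∈ = inj₂ f∈

  bridge : ∀ {d} → Indep d ((x , y) ∷ []) → d x ≢ d y
  bridge (p ∷ []) = p

-- Turns the recursive definition into a condition on each edge and those in front of it, the form
-- in which a closing edge yields a cycle.
Indep-prefix : (∀ xs {x y} ys → es ≡ xs ++ (x , y) ∷ ys → mergeAll c xs x ≢ mergeAll c xs y) →
               Indep c es
Indep-prefix {es = []} _ = []
Indep-prefix {es = (x , y) ∷ es} h =
  h [] es refl ∷ Indep-prefix (λ xs ys eq → h ((x , y) ∷ xs) ys (cong ((x , y) ∷_) eq))

-- Matroid exchange: as `es` loses its independence after `ps`, some edge of `ps` has its ends
-- joined by `es` and the earlier edges of `ps`. It is redundant once `es` is present, and `qs` is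
-- `ps` without it.
Indep-exchange : ∀ ps → Indep c es → ¬ Indep (mergeAll c ps) es →
                 ∃[ qs ] (length ps ≡ suc (length qs) ×
                          mergeAll c ps ⊑ mergeAll (mergeAll c es) qs)
Indep-exchange [] i ¬i = contradiction i ¬i
Indep-exchange {c = c} {es = es} ((x , y) ∷ ps) i ¬i with mergeAll c es x ≟ mergeAll c es y
... | yes eq = ps , refl , mergeAll-mono {es = ps}
  (mergeAll-least-⊑ {es = (x , y) ∷ []} (mergeAll-⊑ c es) λ { (here refl) → eq }) (λ e∈ → e∈)
-- This edge is kept. It is independent after `es`, so moving it to the front leaves `es`
-- independent over `merge c (x , y)`.
... | no ≢ with Indep-++-comm {fs = (x , y) ∷ []} es (Indep-++⁺ i (≢ ∷ []))
...   | _ ∷ i′ with Indep-exchange ps i′ ¬i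
...     | qs , len , ps⊑qs = (x , y) ∷ qs , cong suc len , ⊑-trans ps⊑qs reorder
  where
  reorder : mergeAll (mergeAll (merge c (x , y)) es) qs ⊑ mergeAll (mergeAll c es) ((x , y) ∷ qs)
  reorder = subst₂ _⊑_ (mergeAll-++ c ((x , y) ∷ es) qs) (mergeAll-++ c es ((x , y) ∷ qs))
              (mergeAll-mono ⊑-refl (∈-resp-↭ (↭-sym (shift (x , y) es qs))))

-- Splitting filtered edge lists

module _ {A : Set} {P Q R : Pred A 0ℓ} (P? : U.Decidable P) (Q? : U.Decidable Q) (R? : U.Decidable R)
         (P⇒ : ∀ {x} → P x → Q x ⊎ R x) (Q⇒P : ∀ {x} → Q x → P x) (R⇒P : ∀ {x} → R x → P x)
         (disjoint : ∀ {x} → Q x → ¬ R x) where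

  filter-⊎ : ∀ xs → filter P? xs ↭ filter Q? xs ++ filter R? xs
  filter-⊎ [] = ↭.refl
  filter-⊎ (x ∷ xs) with P? x | Q? x | R? x
  ... | yes p | yes q | yes r = contradiction r (disjoint q)
  ... | yes p | yes q | no _  = ↭.prep x (filter-⊎ xs)
  ... | yes p | no _  | yes r = ↭.trans (↭.prep x (filter-⊎ xs)) (↭-sym (shift x (filter Q? xs) (filter R? xs)))
  ... | yes p | no ¬q | no ¬r = contradiction (P⇒ p) λ { (inj₁ q) → ¬q q ; (inj₂ r) → ¬r r }
  ... | no ¬p | yes q | _     = contradiction (Q⇒P q) ¬p
  ... | no ¬p | no _  | yes r = contradiction (R⇒P r) ¬p
  ... | no _  | no _  | no _  = filter-⊎ xs

-- The entries outside `Q` are moved to the end and dropped.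
Indep-filter : ∀ {P Q : Pred (Edge m) 0ℓ} (P? : U.Decidable P) (Q? : U.Decidable Q) → (∀ {x} → Q x → P x) →
               ∀ xs → Indep c (filter P? xs) → Indep c (filter Q? xs)
Indep-filter {P = P} {Q} P? Q? Q⇒P xs i =
  proj₁ (Indep-++⁻ (filter Q? xs) (Indep-↭
    (filter-⊎ P? Q? (λ x → P? x ×-dec ¬? (Q? x)) split Q⇒P proj₁ (λ q (_ , ¬q) → ¬q q) xs) i))
  where
  split : ∀ {x} → P x → Q x ⊎ (P x × ¬ Q x)
  split {x} p with Q? x
  ... | yes q = inj₁ q
  ... | no ¬q = inj₂ (p , ¬q)

-- Disjoint splits of vertex sets and their sizes

Disjoint : Subset n → Subset n → Set
Disjoint A B = ∀ {x} → x ∈ A → x ∉ B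

record IsSplit (W A B : Subset n) : Set where
  field
    cover    : ∀ {x} → x ∈ W → x ∈ A ⊎ x ∈ B
    left     : A ⊆ W
    right    : B ⊆ W
    disjoint : Disjoint A B

x∈p─q⇒x∉q : ∀ (p q : Subset n) {x} → x ∈ p ─ q → x ∉ q
x∈p─q⇒x∉q (_ ∷ p) (outside ∷ q) (there x∈) (there x∈q) = x∈p─q⇒x∉q p q x∈ x∈q
x∈p─q⇒x∉q (_ ∷ p) (inside ∷ q)  (there x∈) (there x∈q) = x∈p─q⇒x∉q p q x∈ x∈q

x∈p-y⇒x≢y : ∀ (p : Subset n) {x y} → x ∈ p - y → x ≢ y
x∈p-y⇒x≢y p x∈ refl = x∉p-x p x∈

split-∩─ : ∀ (W A : Subset n) → IsSplit W (W ∩ A) (W ─ A)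
split-∩─ W A = record
  { cover    = λ {x} x∈W → cover x x∈W
  ; left     = p∩q⊆p W A
  ; right    = p─q⊆p W A
  ; disjoint = λ x∈ x∉ → x∈p─q⇒x∉q W A x∉ (p∩q⊆q W A x∈)
  }
  where
  cover : ∀ x → x ∈ W → x ∈ W ∩ A ⊎ x ∈ W ─ A
  cover x x∈W with x ∈? A
  ... | yes x∈A = inj₁ (x∈p∩q⁺ (x∈W , x∈A))
  ... | no x∉A  = inj₂ (x∈p∧x∉q⇒x∈p─q x∈W x∉A)

split-sym : ∀ {W A B : Subset n} → IsSplit W A B → IsSplit W B A
split-sym s = record
  { cover = λ x∈ → swap⊎ (cover x∈) ; left = right ; right = left
  ; disjoint = λ x∈B x∈A → disjoint x∈A x∈B }
  where open IsSplit s

split-∪ : ∀ {A B : Subset n} → Disjoint A B → IsSplit (A ∪ B) A B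
split-∪ {A = A} {B} disj = record
  { cover = x∈p∪q⁻ A B ; left = p⊆p∪q B ; right = q⊆p∪q A B ; disjoint = disj }

split-remove : ∀ {W : Subset n} {v} → v ∈ W → IsSplit W ⁅ v ⁆ (W - v)
split-remove {W = W} {v} v∈W = record
  { cover    = λ {x} x∈W → cover x x∈W
  ; left     = λ x∈ → subst (_∈ W) (sym (x∈⁅y⁆⇒x≡y v x∈)) v∈W
  ; right    = p─q⊆p W ⁅ v ⁆
  ; disjoint = λ x∈ x∈W-v → x∈p-y⇒x≢y W x∈W-v (x∈⁅y⁆⇒x≡y v x∈)
  }
  where
  cover : ∀ x → x ∈ W → x ∈ ⁅ v ⁆ ⊎ x ∈ W - v
  cover x x∈W with x ≟ v
  ... | yes refl = inj₁ (x∈⁅x⁆ v)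
  ... | no x≢v   = inj₂ (x∈p∧x≢y⇒x∈p-y x∈W x≢v)

∣split∣ : ∀ {W A B : Subset n} → IsSplit W A B → ∣ W ∣ ≡ ∣ A ∣ + ∣ B ∣
∣split∣ {W = []} {[]} {[]} s = refl
∣split∣ {W = w ∷ W} {a ∷ A} {b ∷ B} s with ∣split∣ tails
  where
  module S = IsSplit s
  drop-⊎ : ∀ {x} → suc x ∈ a ∷ A ⊎ suc x ∈ b ∷ B → x ∈ A ⊎ x ∈ B
  drop-⊎ (inj₁ (there x∈)) = inj₁ x∈
  drop-⊎ (inj₂ (there x∈)) = inj₂ x∈
  tails : IsSplit W A B
  tails = record
    { cover    = λ x∈ → drop-⊎ (S.cover (there x∈))
    ; left     = λ x∈ → drop-there (S.left (there x∈))
    ; right    = λ x∈ → drop-there (S.right (there x∈))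
    ; disjoint = λ x∈ x∈′ → S.disjoint (there x∈) (there x∈′)
    }
∣split∣ {W = outside ∷ W} {outside ∷ A} {outside ∷ B} s | eq = eq
∣split∣ {W = inside ∷ W}  {inside ∷ A}  {outside ∷ B} s | eq = cong suc eq
∣split∣ {W = inside ∷ W}  {outside ∷ A} {inside ∷ B}  s | eq = trans (cong suc eq) (sym (ℕ.+-suc _ _))
∣split∣ {W = _}           {inside ∷ A}  {inside ∷ B}  s | eq = contradiction here (IsSplit.disjoint s here)
∣split∣ {W = outside ∷ W} {inside ∷ A}  {_}           s | eq = contradiction (IsSplit.left s here) λ ()
∣split∣ {W = outside ∷ W} {_}           {inside ∷ B}  s | eq = contradiction (IsSplit.right s here) λ ()
∣split∣ {W = inside ∷ W}  {outside ∷ A} {outside ∷ B} s | eq with IsSplit.cover s here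
... | inj₁ ()
... | inj₂ ()

∣p∪q∣≤∣p∣+∣q∣ : ∀ (p q : Subset n) → ∣ p ∪ q ∣ ≤ ∣ p ∣ + ∣ q ∣
∣p∪q∣≤∣p∣+∣q∣ p q = subst (_≤ ∣ p ∣ + ∣ q ∣) (sym (∣split∣ (split-∩─ (p ∪ q) p)))
  (ℕ.+-mono-≤ (∣p∩q∣≤∣q∣ (p ∪ q) p) (p⊆q⇒∣p∣≤∣q∣ rest))
  where
  rest : (p ∪ q) ─ p ⊆ q
  rest x∈ with x∈p∪q⁻ p q (p─q⊆p (p ∪ q) p x∈)
  ... | inj₁ x∈p = contradiction x∈p (x∈p─q⇒x∉q (p ∪ q) p x∈)
  ... | inj₂ x∈q = x∈q

-- Edges between a vertex set and the kept vertices

module _ {n : ℕ} (G : Graph n) where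

  open Graph G

  -- Vertex zero is an additional vertex adjacent to the vertices of T (and
  -- suc v is the vertex v of G), so that a graph with this vertex is acyclic
  -- iff it is without it and no two vertices of T are joined.

  Meets : Subset n → Subset n → Fin n → Fin n → Set
  Meets K W u v = (u ∈ W × v ∈ W) ⊎ (u ∈ W × v ∈ K) ⊎ (u ∈ K × v ∈ W)

  -- The order `u <ᶠ v` lists every edge once. Edges inside `K` are left out: the colouring already
  -- accounts for them.
  Live : Subset n → Subset n → Subset n → Pred (Edge (suc n)) 0ℓ
  Live K T W (_     , zero)  = ⊥′
  Live K T W (zero  , suc v) = v ∈ T × v ∈ W
  Live K T W (suc u , suc v) = u <ᶠ v × Adj u v × Meets K W u v

  live? : ∀ K T W → U.Decidable (Live K T W)
  live? K T W (_     , zero)  = no λ ()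
  live? K T W (zero  , suc v) = (v ∈? T) ×-dec (v ∈? W)
  live? K T W (suc u , suc v) =
    (u Fin.<? v) ×-dec adj? u v ×-dec
      (((u ∈? W) ×-dec (v ∈? W)) ⊎-dec ((u ∈? W) ×-dec (v ∈? K)) ⊎-dec ((u ∈? K) ×-dec (v ∈? W)))

  allPairs : List (Edge (suc n))
  allPairs = cartesianProduct (allFin _) (allFin _)

  edges : Subset n → Subset n → Subset n → List (Edge (suc n))
  edges K T W = filter (live? K T W) allPairs

  ∈-edges⁺ : ∀ {K T W e} → Live K T W e → e ∈ˡ edges K T W
  ∈-edges⁺ {K} {T} {W} l =
    ∈-filter⁺ (live? K T W) (∈-cartesianProduct⁺ (∈-allFin _) (∈-allFin _)) l

  ∈-edges⁻ : ∀ {K T W e} → e ∈ˡ edges K T W → Live K T W e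
  ∈-edges⁻ {K} {T} {W} e∈ = proj₂ (∈-filter⁻ (live? K T W) {xs = allPairs} e∈)

  edges-unique : ∀ K T W → Unique (edges K T W)
  edges-unique K T W =
    Unique.filter⁺ (live? K T W) (Unique.cartesianProduct⁺ (Unique.allFin⁺ _) (Unique.allFin⁺ _))

  Meets-mono : ∀ {K K′ W W′ u v} → K′ ⊆ K → W′ ⊆ W → Meets K′ W′ u v → Meets K W u v
  Meets-mono K⊆ W⊆ (inj₁ (u∈ , v∈))        = inj₁ (W⊆ u∈ , W⊆ v∈)
  Meets-mono K⊆ W⊆ (inj₂ (inj₁ (u∈ , v∈))) = inj₂ (inj₁ (W⊆ u∈ , K⊆ v∈))
  Meets-mono K⊆ W⊆ (inj₂ (inj₂ (u∈ , v∈))) = inj₂ (inj₂ (K⊆ u∈ , W⊆ v∈))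

  Live-mono : ∀ {K K′ T T′ W W′} → K′ ⊆ K → T′ ⊆ T → W′ ⊆ W → ∀ {e} → Live K′ T′ W′ e → Live K T W e
  Live-mono K⊆ T⊆ W⊆ {zero  , suc v} (v∈T , v∈W) = T⊆ v∈T , W⊆ v∈W
  Live-mono K⊆ T⊆ W⊆ {suc u , suc v} (u<v , a , meets) = u<v , a , Meets-mono K⊆ W⊆ meets

  Indep-edges-anti : ∀ {c K K′ T T′ W W′} → K′ ⊆ K → T′ ⊆ T → W′ ⊆ W →
                     Indep c (edges K T W) → Indep c (edges K′ T′ W′)
  Indep-edges-anti {K = K} {K′} {T} {T′} {W} {W′} K⊆ T⊆ W⊆ =
    Indep-filter (live? K T W) (live? K′ T′ W′) (λ {e} → Live-mono K⊆ T⊆ W⊆ {e}) allPairs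

  Apart : Subset n → Subset n → Set
  Apart A B = ∀ {x y} → x ∈ A → y ∈ B → ¬ Adj x y

  -- For `B` the vertices of `A` count as kept, so an edge between `A` and `B` is listed exactly
  -- once, namely with `B`.
  edges-split : ∀ {K W A B} → Disjoint K W → IsSplit W A B → ∀ T →
                edges K T W ↭ edges K T A ++ edges (K ∪ A) T B
  edges-split {K} {W} {A} {B} disj s T =
    filter-⊎ (live? K T W) (live? K T A) (live? (K ∪ A) T B)
      (λ {e} → live-⊎ {e}) (λ {e} → Live-mono (λ x∈ → x∈) (λ x∈ → x∈) left {e})
      (λ {e} → live-right {e}) (λ {e} → exclusive {e}) allPairs
    where
    open IsSplit s
    inA : ∀ {x} → x ∈ A → x ∈ K ∪ A
    inA = q⊆p∪q K A
    inK : ∀ {x} → x ∈ K → x ∈ K ∪ A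
    inK = p⊆p∪q A

    meets-⊎ : ∀ {u v} → Meets K W u v → Meets K A u v ⊎ Meets (K ∪ A) B u v
    meets-⊎ (inj₁ (u∈ , v∈)) with cover u∈ | cover v∈
    ... | inj₁ p | inj₁ q = inj₁ (inj₁ (p , q))
    ... | inj₁ p | inj₂ q = inj₂ (inj₂ (inj₂ (inA p , q)))
    ... | inj₂ p | inj₁ q = inj₂ (inj₂ (inj₁ (p , inA q)))
    ... | inj₂ p | inj₂ q = inj₂ (inj₁ (p , q))
    meets-⊎ (inj₂ (inj₁ (u∈ , v∈))) with cover u∈
    ... | inj₁ p = inj₁ (inj₂ (inj₁ (p , v∈)))
    ... | inj₂ p = inj₂ (inj₂ (inj₁ (p , inK v∈)))
    meets-⊎ (inj₂ (inj₂ (u∈ , v∈))) with cover v∈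
    ... | inj₁ p = inj₁ (inj₂ (inj₂ (u∈ , p)))
    ... | inj₂ p = inj₂ (inj₂ (inj₂ (inK u∈ , p)))

    live-⊎ : ∀ {e} → Live K T W e → Live K T A e ⊎ Live (K ∪ A) T B e
    live-⊎ {zero  , suc v} (v∈T , v∈W) with cover v∈W
    ... | inj₁ p = inj₁ (v∈T , p)
    ... | inj₂ p = inj₂ (v∈T , p)
    live-⊎ {suc u , suc v} (u<v , a , meets) with meets-⊎ meets
    ... | inj₁ p = inj₁ (u<v , a , p)
    ... | inj₂ p = inj₂ (u<v , a , p)

    meets-right : ∀ {u v} → Meets (K ∪ A) B u v → Meets K W u v
    meets-right (inj₁ (u∈ , v∈)) = inj₁ (right u∈ , right v∈)
    meets-right (inj₂ (inj₁ (u∈ , v∈))) with x∈p∪q⁻ K A v∈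
    ... | inj₁ v∈K = inj₂ (inj₁ (right u∈ , v∈K))
    ... | inj₂ v∈A = inj₁ (right u∈ , left v∈A)
    meets-right (inj₂ (inj₂ (u∈ , v∈))) with x∈p∪q⁻ K A u∈
    ... | inj₁ u∈K = inj₂ (inj₂ (u∈K , right v∈))
    ... | inj₂ u∈A = inj₁ (left u∈A , right v∈)

    live-right : ∀ {e} → Live (K ∪ A) T B e → Live K T W e
    live-right {zero  , suc v} (v∈T , v∈B) = v∈T , right v∈B
    live-right {suc u , suc v} (u<v , a , meets) = u<v , a , meets-right meets

    outsideB : ∀ {x} → x ∈ A ⊎ x ∈ K → x ∉ B
    outsideB (inj₁ x∈A) = disjoint x∈A
    outsideB (inj₂ x∈K) x∈B = disj x∈K (right x∈B)

    both : ∀ {u v} → Meets K A u v → (u ∈ A ⊎ u ∈ K) × (v ∈ A ⊎ v ∈ K)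
    both (inj₁ (u∈ , v∈))        = inj₁ u∈ , inj₁ v∈
    both (inj₂ (inj₁ (u∈ , v∈))) = inj₁ u∈ , inj₂ v∈
    both (inj₂ (inj₂ (u∈ , v∈))) = inj₂ u∈ , inj₁ v∈

    one : ∀ {u v} → Meets (K ∪ A) B u v → u ∈ B ⊎ v ∈ B
    one (inj₁ (u∈ , _))        = inj₁ u∈
    one (inj₂ (inj₁ (u∈ , _))) = inj₁ u∈
    one (inj₂ (inj₂ (_ , v∈))) = inj₂ v∈

    exclusive : ∀ {e} → Live K T A e → ¬ Live (K ∪ A) T B e
    exclusive {zero  , suc v} (_ , v∈A) (_ , v∈B) = disjoint v∈A v∈B
    exclusive {suc u , suc v} (_ , _ , p) (_ , _ , q) with both p | one q
    ... | u∈ , _ | inj₁ u∈B = outsideB u∈ u∈B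
    ... | _ , v∈ | inj₂ v∈B = outsideB v∈ v∈B

  edges-apart : ∀ {K A B} → Apart A B → ∀ T →
                ∀ {e} → Live (K ∪ A) T B e → Live K T B e
  edges-apart apart T {zero  , suc v} l = l
  edges-apart {K} {A} {B} apart T {suc u , suc v} (u<v , a , inj₁ p) = u<v , a , inj₁ p
  edges-apart {K} {A} {B} apart T {suc u , suc v} (u<v , a , inj₂ (inj₁ (u∈ , v∈))) with x∈p∪q⁻ K A v∈
  ... | inj₁ v∈K = u<v , a , inj₂ (inj₁ (u∈ , v∈K))
  ... | inj₂ v∈A = contradiction (adj-sym a) (apart v∈A u∈)
  edges-apart {K} {A} {B} apart T {suc u , suc v} (u<v , a , inj₂ (inj₂ (u∈ , v∈))) with x∈p∪q⁻ K A u∈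
  ... | inj₁ u∈K = u<v , a , inj₂ (inj₂ (u∈K , v∈))
  ... | inj₂ u∈A = contradiction a (apart u∈A v∈)

  module _ {K W A B : Subset n} (disj : Disjoint K W) (s : IsSplit W A B)
           {c : Colouring (suc n)} {T : Subset n} where

    Indep-split⁻ : Indep c (edges K T W) →
                   Indep c (edges K T A) × Indep (mergeAll c (edges K T A)) (edges (K ∪ A) T B)
    Indep-split⁻ i = Indep-++⁻ (edges K T A) (Indep-↭ (edges-split disj s T) i)

    Indep-split⁺ : Indep c (edges K T A) → Indep (mergeAll c (edges K T A)) (edges (K ∪ A) T B) →
                   Indep c (edges K T W)
    Indep-split⁺ i j = Indep-↭ (↭-sym (edges-split disj s T)) (Indep-++⁺ i j)

    Indep-apart⁻ : Indep c (edges K T W) →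
                   Indep c (edges K T A) × Indep (mergeAll c (edges K T A)) (edges K T B)
    Indep-apart⁻ i with j , k ← Indep-split⁻ i =
      j , Indep-edges-anti (p⊆p∪q A) (λ x∈ → x∈) (λ x∈ → x∈) k

    Indep-apart⁺ : Apart A B → Indep c (edges K T A) → Indep (mergeAll c (edges K T A)) (edges K T B) →
                   Indep c (edges K T W)
    Indep-apart⁺ apart i j = Indep-split⁺ i
      (Indep-filter (live? K T B) (live? (K ∪ A) T B) (λ {e} → edges-apart apart T {e}) allPairs j)

-- Simple paths by loop erasure

data Path {A : Set} (R : Rel A 0ℓ) : A → List A → A → Set where
  []  : ∀ {u} → Path R u [] u
  _∷_ : ∀ {u w ws v} → R u w → Path R w ws v → Path R u (w ∷ ws) v

module _ {R : Rel (Fin n) 0ℓ} where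

  path-from : ∀ {u w ws v} → Path R w ws v → Unique (w ∷ ws) → u ∈ˡ w ∷ ws →
              ∃[ us ] (Path R u us v × Unique (u ∷ us))
  path-from p        uniq       (here refl) = _ , p , uniq
  path-from (_ ∷ p)  (_ ∷ uniq) (there u∈)  = path-from p uniq u∈

  simple-path : ∀ {u v} → Star R u v → ∃[ us ] (Path R u us v × Unique (u ∷ us))
  simple-path ε = [] , [] , [] ∷ []
  simple-path {u} (_◅_ {j = w} r rs) with simple-path rs
  ... | ws , p , uniq with DecMembership._∈?_ _≟_ u (w ∷ ws)
  ...   | yes u∈ = path-from p uniq u∈
  ...   | no u∉  = w ∷ ws , r ∷ p , ¬Any⇒All¬ _ u∉ ∷ uniq

  path-all : ∀ {P : Pred (Fin n) 0ℓ} {u us v} → (∀ {x y} → R x y → P y) → Path R u us v → All P us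
  path-all f []      = []
  path-all f (r ∷ p) = f r ∷ path-all f p

  path-linked : ∀ {S : Rel (Fin n) 0ℓ} {u us v x} → (∀ {x y} → R x y → S x y) → Path R u us v →
                S v x → Linked S (u ∷ us ∷ʳ x)
  path-linked f []      s = s ∷ [-]
  path-linked f (r ∷ p) s = f r ∷ path-linked f p s

unique-++-∉ : ∀ {A : Set} xs {z : A} {ys} → Unique (xs ++ z ∷ ys) → ¬ z ∈ˡ xs
unique-++-∉ (x ∷ xs) (x∉ ∷ _)  (here refl) = All.lookup x∉ (∈-++⁺ʳ xs (here refl)) refl
unique-++-∉ (x ∷ xs) (_ ∷ uniq) (there z∈) = unique-++-∉ xs uniq z∈

-- Independence versus acyclicity and separation of `T`

module _ {n : ℕ} (G : Graph n) where

  open Graph G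

  ∈-edges-adj : ∀ {K T W u v} → Adj u v → Meets G K W u v →
                (suc u , suc v) ∈ˡ edges G K T W ⊎ (suc v , suc u) ∈ˡ edges G K T W
  ∈-edges-adj {u = u} {v} a meets with Fin.<-cmp u v
  ... | tri< u<v _ _  = inj₁ (∈-edges⁺ G (u<v , a , meets))
  ... | tri≈ _ refl _ = contradiction a irrefl
  ... | tri> _ _ v<u  = inj₂ (∈-edges⁺ G (v<u , adj-sym a , flip meets))
    where
    flip : Meets G _ _ u v → Meets G _ _ v u
    flip (inj₁ (u∈ , v∈))        = inj₁ (v∈ , u∈)
    flip (inj₂ (inj₁ (u∈ , v∈))) = inj₂ (inj₂ (v∈ , u∈))
    flip (inj₂ (inj₂ (u∈ , v∈))) = inj₂ (inj₁ (v∈ , u∈))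

  Joined-class : ∀ (c : Colouring (suc n)) {D u v} →
                 (∀ {x y} → x ∈ D → y ∈ D → Adj x y → c (suc x) ≡ c (suc y)) →
                 Joined G D u v → c (suc u) ≡ c (suc v)
  Joined-class c {D} h (_ , _ , p) = go p
    where
    go : ∀ {u v} → Star (AdjIn G D) u v → c (suc u) ≡ c (suc v)
    go ε                  = refl
    go ((x∈ , y∈ , a) ◅ p) = trans (h x∈ y∈ a) (go p)

  module _ {T A : Subset n} (indep : Indep id (edges G ⊥ T A)) where

    -- Otherwise the edge from `zero` to `v` closes a cycle with the edge from `zero` to `u` and the
    -- walk from `u` to `v`.
    T-separated : ∀ {u v} → u ∈ T → v ∈ T → Joined G A u v → u ≡ v
    T-separated {u} {v} u∈T v∈T j@(u∈A , v∈A , _) with u ≟ v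
    ... | yes eq = eq
    ... | no u≢v with Indep-bridge indep (∈-edges⁺ G {e = zero , suc v} (v∈T , v∈A))
    ...   | fs , others , ≢ = contradiction
              (trans (mergeAll-joins id zu∈) (Joined-class (mergeAll id fs) adjacent j)) ≢
      where
      zu∈ : (zero , suc u) ∈ˡ fs
      zu∈ with others (∈-edges⁺ G {e = zero , suc u} (u∈T , u∈A))
      ... | inj₁ refl = contradiction refl u≢v
      ... | inj₂ f∈   = f∈

      adjacent : ∀ {x y} → x ∈ A → y ∈ A → Adj x y → mergeAll id fs (suc x) ≡ mergeAll id fs (suc y)
      adjacent x∈ y∈ a with ∈-edges-adj a (inj₁ (x∈ , y∈))
      adjacent x∈ y∈ a | inj₁ e∈ with others e∈
      ... | inj₂ f∈ = mergeAll-joins id f∈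
      adjacent x∈ y∈ a | inj₂ e∈ with others e∈
      ... | inj₂ f∈ = sym (mergeAll-joins id f∈)

    -- Otherwise the edge from `x` to `v` is no bridge: `x` reaches `v` through `u` and the walk
    -- that avoids `x`.
    unique-neighbour : ∀ {x u v} → x ∈ A → Adj x u → Adj x v → Joined G (A - x) u v → u ≡ v
    unique-neighbour {x} {u} {v} x∈A xu xv j@(u∈ , v∈ , _) with u ≟ v
    ... | yes eq = eq
    ... | no u≢v = ⊥-elim (bridge (∈-edges-adj xv (inj₁ (x∈A , p─q⊆p A _ v∈))))
      where
      Closes : List (Edge (suc n)) → Set
      Closes fs = mergeAll id fs (suc x) ≡ mergeAll id fs (suc v)

      -- Both orientations are allowed, since the edge is listed with its smaller end first.
      avoiding : ∀ {fs} → (∀ {f} → f ∈ˡ edges G ⊥ T A →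
                             f ≡ (suc x , suc v) ⊎ f ≡ (suc v , suc x) ⊎ f ∈ˡ fs) → Closes fs
      avoiding {fs} others = trans (step x∈A (p─q⊆p A _ u∈) xu (λ (_ , eq) → u≢v eq) λ (eq , _) → x≢v eq)
        (Joined-class (mergeAll id fs) (λ y∈ z∈ a → step (p─q⊆p A _ y∈) (p─q⊆p A _ z∈) a
            (λ (eq , _) → x∈p-y⇒x≢y A y∈ eq) (λ (_ , eq) → x∈p-y⇒x≢y A z∈ eq)) j)
        where
        x≢v : x ≢ v
        x≢v refl = x∉p-x A v∈

        step : ∀ {y z} → y ∈ A → z ∈ A → Adj y z → ¬ (y ≡ x × z ≡ v) → ¬ (y ≡ v × z ≡ x) →
               mergeAll id fs (suc y) ≡ mergeAll id fs (suc z)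
        step y∈ z∈ a ≢₁ ≢₂ with ∈-edges-adj a (inj₁ (y∈ , z∈))
        step y∈ z∈ a ≢₁ ≢₂ | inj₁ e∈ with others e∈
        ... | inj₁ eq        = contradiction (suc-injective (cong proj₁ eq) , suc-injective (cong proj₂ eq)) ≢₁
        ... | inj₂ (inj₁ eq) = contradiction (suc-injective (cong proj₁ eq) , suc-injective (cong proj₂ eq)) ≢₂
        ... | inj₂ (inj₂ f∈) = mergeAll-joins id f∈
        step y∈ z∈ a ≢₁ ≢₂ | inj₂ e∈ with others e∈
        ... | inj₁ eq        = contradiction (suc-injective (cong proj₂ eq) , suc-injective (cong proj₁ eq)) ≢₂
        ... | inj₂ (inj₁ eq) = contradiction (suc-injective (cong proj₂ eq) , suc-injective (cong proj₁ eq)) ≢₁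
        ... | inj₂ (inj₂ f∈) = sym (mergeAll-joins id f∈)

      bridge : (suc x , suc v) ∈ˡ edges G ⊥ T A ⊎ (suc v , suc x) ∈ˡ edges G ⊥ T A → ⊥′
      bridge = λ where
        (inj₁ e∈) → let fs , others , ≢ = Indep-bridge indep e∈
                    in ≢ (avoiding λ f∈ → [ inj₁ , (λ q → inj₂ (inj₂ q)) ]′ (others f∈))
        (inj₂ e∈) → let fs , others , ≢ = Indep-bridge indep e∈
                    in ≢ (sym (avoiding λ f∈ → inj₂ (others f∈)))

    last-step : ∀ {D x} xs {v} → All (_∈ D) (x ∷ xs) → Linked Adj (x ∷ xs ∷ʳ v) →
                ∃[ y ] (y ∈ˡ x ∷ xs × Adj y v × Joined G D x y)
    last-step []       (x∈ ∷ _)  (a ∷ _)  = _ , here refl , a , Joined-refl G x∈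
    last-step (z ∷ zs) (x∈ ∷ in-D@(z∈ ∷ _)) (a ∷ l) with last-step zs in-D l
    ... | y , y∈ , b , (_ , y∈D , p) = y , there y∈ , b , x∈ , y∈D , (x∈ , z∈ , a) ◅ p

    -- The second and the last vertex of a cycle are neighbours of `v` joined without `v`, hence
    -- equal, but a cycle repeats no vertex.
    indep⇒forest : Forest G A
    indep⇒forest (v , x ∷ z ∷ zs , _ , v∈ ∷ in-A@(x∈A ∷ in-A′) , v∉ ∷ x∉ ∷ _ , a ∷ b ∷ l)
      with All.zipWith (λ (w∈ , v≢w) → x∈p∧x≢y⇒x∈p-y w∈ λ eq → v≢w (sym eq)) (in-A , v∉)
    ... | x∈ ∷ in-D@(z∈ ∷ _) with last-step zs in-D l
    ...   | y , y∈ , yv , (_ , y∈D , p) =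
      All.lookup x∉ y∈ (unique-neighbour v∈ a (adj-sym yv) (x∈ , y∈D , (x∈ , z∈ , b) ◅ p))
    indep⇒forest (_ , [] , () , _)
    indep⇒forest (_ , _ ∷ [] , s≤s () , _)

  private module _ {A : Subset n} where

    Step : List (Edge (suc n)) → Rel (Fin n) 0ℓ
    Step xs u v = (suc u , suc v) ∈ˡ xs ⊎ (suc v , suc u) ∈ˡ xs

    -- With no labels in `T` the additional vertex is isolated and therefore related only to itself.
    SameTree : List (Edge (suc n)) → Rel (Fin (suc n)) 0ℓ
    SameTree xs zero    zero    = ⊤′
    SameTree xs (suc u) (suc v) = Star (Step xs) u v
    SameTree xs zero    (suc _) = ⊥′
    SameTree xs (suc _) zero    = ⊥′

    Step-sym : ∀ {xs u v} → Step xs u v → Step xs v u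
    Step-sym (inj₁ p) = inj₂ p
    Step-sym (inj₂ p) = inj₁ p

    SameTree-equiv : ∀ {xs} → IsEquivalence (SameTree xs)
    SameTree-equiv {xs} = record
      { refl  = λ {x} → rfl x
      ; sym   = λ {x} {y} → sy x y
      ; trans = λ {x} {y} {z} → tr x y z }
      where
      rfl : ∀ x → SameTree xs x x
      rfl zero    = _
      rfl (suc _) = ε
      sy : ∀ x y → SameTree xs x y → SameTree xs y x
      sy zero    zero    _ = _
      sy (suc _) (suc _) p = reverse Step-sym p
      tr : ∀ x y z → SameTree xs x y → SameTree xs y z → SameTree xs x z
      tr zero    zero    zero    _ _ = _
      tr (suc _) (suc _) (suc _) p q = p ◅◅ q

    mergeAll-tree : ∀ {xs} → xs ⊆ˡ edges G ⊥ ⊥ A →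
                    ∀ {u v} → mergeAll id xs u ≡ mergeAll id xs v → SameTree xs u v
    mergeAll-tree {xs} xs⊆ = mergeAll-least SameTree-equiv (λ {u} {v} → base {u} {v}) joins
      where
      base : ∀ {u v} → u ≡ v → SameTree xs u v
      base {u} refl = IsEquivalence.refl SameTree-equiv {u}
      joins : ∀ {x y} → (x , y) ∈ˡ xs → SameTree xs x y
      joins {x} {zero} e∈ = ⊥-elim (∈-edges⁻ G {⊥} {⊥} {A} {x , zero} (xs⊆ e∈))
      joins {zero} {suc v} e∈ = contradiction (proj₁ (∈-edges⁻ G {⊥} {⊥} {A} {zero , suc v} (xs⊆ e∈))) ∉⊥
      joins {suc u} {suc v} e∈ = inj₁ e∈ ◅ ε

    step-in : ∀ {xs} → xs ⊆ˡ edges G ⊥ ⊥ A → ∀ {u v} → Step xs u v → AdjIn G A u v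
    step-in {xs} xs⊆ {u} {v} (inj₁ e∈) with ∈-edges⁻ G {⊥} {⊥} {A} {suc u , suc v} (xs⊆ e∈)
    ... | _ , a , inj₁ (u∈ , v∈) = u∈ , v∈ , a
    ... | _ , a , inj₂ (inj₁ (_ , v∈)) = contradiction v∈ ∉⊥
    ... | _ , a , inj₂ (inj₂ (u∈ , _)) = contradiction u∈ ∉⊥
    step-in {xs} xs⊆ {u} {v} (inj₂ e∈) with step-in xs⊆ {v} {u} (inj₁ e∈)
    ... | v∈ , u∈ , a = u∈ , v∈ , adj-sym a

    -- An edge whose ends are already in one class closes a cycle with a simple path of earlier
    -- edges.
    forest⇒indep-⊥ : Forest G A → Indep id (edges G ⊥ ⊥ A)
    forest⇒indep-⊥ forest = Indep-prefix acyclic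
      where
      middle : ∀ xs {e ys} → edges G ⊥ ⊥ A ≡ xs ++ e ∷ ys → e ∈ˡ edges G ⊥ ⊥ A
      middle xs {e} eq = subst (e ∈ˡ_) (sym eq) (∈-++⁺ʳ xs (here refl))
      prefix : ∀ xs {ys} → edges G ⊥ ⊥ A ≡ xs ++ ys → xs ⊆ˡ edges G ⊥ ⊥ A
      prefix xs eq {e} e∈ = subst (e ∈ˡ_) (sym eq) (∈-++⁺ˡ e∈)

      cycle : ∀ xs {u v} ys → edges G ⊥ ⊥ A ≡ xs ++ (suc u , suc v) ∷ ys → ¬ Star (Step xs) u v
      cycle xs {u} {v} ys eq star
        with simple-path star | ∈-edges⁻ G {⊥} {⊥} {A} {suc u , suc v} (middle xs eq)
           | step-in (λ e∈ → e∈) (inj₁ (middle xs eq))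
      ... | us , p , uniq | u<v , _ , _ | u∈ , _ , a =
        forest (u , us , long p , u∈ ∷ path-all (λ s → proj₁ (proj₂ (step-in xs⊆ s))) p , uniq
               , path-linked (λ s → proj₂ (proj₂ (step-in xs⊆ s))) p (adj-sym a))
        where
        xs⊆ = prefix xs eq
        -- A path of one step would be the closing edge itself: in the same orientation it
        -- contradicts uniqueness of the list, reversed it contradicts the order of the ends.
        long : ∀ {us} → Path (Step xs) u us v → 2 ≤ length us
        long []                    = contradiction u<v (Fin.<-irrefl refl)
        long (inj₁ e∈ ∷ [])        =
          contradiction e∈ (unique-++-∉ xs (subst Unique eq (edges-unique G ⊥ ⊥ A)))
        long (inj₂ e∈ ∷ [])        =
          contradiction u<v (Fin.<-asym (proj₁ (∈-edges⁻ G {⊥} {⊥} {A} {suc v , suc u} (xs⊆ e∈))))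
        long (_ ∷ _ ∷ _)           = s≤s (s≤s z≤n)

      acyclic : ∀ xs {x y} ys → edges G ⊥ ⊥ A ≡ xs ++ (x , y) ∷ ys → mergeAll id xs x ≢ mergeAll id xs y
      acyclic xs {x} {zero} ys eq _ = ∈-edges⁻ G {⊥} {⊥} {A} {x , zero} (middle xs eq)
      acyclic xs {zero} {suc v} ys eq _ = ∉⊥ (proj₁ (∈-edges⁻ G {⊥} {⊥} {A} {zero , suc v} (middle xs eq)))
      acyclic xs {suc u} {suc v} ys eq eq′ = cycle xs ys eq (mergeAll-tree (prefix xs eq) eq′)

  module _ {A T : Subset n} where

    Spoke : Pred (Edge (suc n)) 0ℓ
    Spoke (zero , suc v) = v ∈ T × v ∈ A
    Spoke _              = ⊥′

    spoke? : U.Decidable Spoke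
    spoke? (zero  , suc v) = (v ∈? T) ×-dec (v ∈? A)
    spoke? (zero  , zero)  = no λ ()
    spoke? (suc _ , _)     = no λ ()

    -- The edges of the forest are added first and the spokes last. A tree contains at most one
    -- vertex of `T`, so every spoke attaches a new tree to `zero`.
    forest⇒indep : Forest G A → (∀ {u v} → u ∈ T → v ∈ T → Joined G A u v → u ≡ v) →
                   Indep id (edges G ⊥ T A)
    forest⇒indep forest separated =
      Indep-↭ (↭-sym σ) (Indep-++⁺ (forest⇒indep-⊥ forest) (Indep-prefix distinct))
      where
      spokes = filter spoke? (allPairs G)

      σ : edges G ⊥ T A ↭ edges G ⊥ ⊥ A ++ spokes
      σ = filter-⊎ (live? G ⊥ T A) (live? G ⊥ ⊥ A) spoke? (λ {e} → to e)
            (λ {e} → Live-mono G (λ x∈ → x∈) (λ x∈ → contradiction x∈ ∉⊥) (λ x∈ → x∈) {e})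
            (λ {e} → from e) (λ {e} → exclusive e) (allPairs G)
        where
        to : ∀ e → Live G ⊥ T A e → Live G ⊥ ⊥ A e ⊎ Spoke e
        to (zero  , suc _) l = inj₂ l
        to (suc _ , suc _) l = inj₁ l
        from : ∀ e → Spoke e → Live G ⊥ T A e
        from (zero , suc _) s = s
        exclusive : ∀ e → Live G ⊥ ⊥ A e → ¬ Spoke e
        exclusive (zero , suc _) (v∈⊥ , _) _ = ∉⊥ v∈⊥

      tree : Colouring (suc n)
      tree = mergeAll id (edges G ⊥ ⊥ A)

      tree⇒same : ∀ {u v} → tree u ≡ tree v → SameTree {A} (edges G ⊥ ⊥ A) u v
      tree⇒same = mergeAll-tree (λ e∈ → e∈)

      spoke⁻ : ∀ {e} → e ∈ˡ spokes → Spoke e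
      spoke⁻ e∈ = proj₂ (∈-filter⁻ spoke? {xs = allPairs G} e∈)

      distinct : ∀ xs {x y} ys → spokes ≡ xs ++ (x , y) ∷ ys → mergeAll tree xs x ≢ mergeAll tree xs y
      distinct xs {x} {y} ys eq eq′ = go x y refl (spoke⁻ (middle (here refl))) joined
        where
        middle : ∀ {e} → e ∈ˡ (x , y) ∷ ys → e ∈ˡ spokes
        middle {e} e∈ = subst (e ∈ˡ_) (sym eq) (∈-++⁺ʳ xs e∈)

        -- `u` lies in the class of `zero` or in a tree that the spokes of `xs` have attached to it.
        Hub : Fin (suc n) → Set
        Hub u = tree u ≡ tree zero ⊎ ∃[ s ] ((zero , s) ∈ˡ xs × tree u ≡ tree s)

        Hub-resp : ∀ {u v} → tree u ≡ tree v → Hub v → Hub u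
        Hub-resp p (inj₁ q)            = inj₁ (trans p q)
        Hub-resp p (inj₂ (s , s∈ , q)) = inj₂ (s , s∈ , trans p q)

        R : Rel (Fin (suc n)) 0ℓ
        R u v = tree u ≡ tree v ⊎ (Hub u × Hub v)

        R-equiv : IsEquivalence R
        R-equiv = record
          { refl  = inj₁ refl
          ; sym   = λ { (inj₁ p) → inj₁ (sym p) ; (inj₂ (p , q)) → inj₂ (q , p) }
          ; trans = λ { (inj₁ p) (inj₁ q) → inj₁ (trans p q)
                      ; (inj₁ p) (inj₂ (q , r)) → inj₂ (Hub-resp p q , r)
                      ; (inj₂ (p , q)) (inj₁ r) → inj₂ (p , Hub-resp (sym r) q)
                      ; (inj₂ (p , _)) (inj₂ (_ , r)) → inj₂ (p , r) } }

        joined : R x y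
        joined = mergeAll-least R-equiv inj₁ (λ {u} {v} e∈ →
          spoke-R u v e∈ (spoke⁻ (subst ((u , v) ∈ˡ_) (sym eq) (∈-++⁺ˡ e∈)))) eq′
          where
          spoke-R : ∀ u v → (u , v) ∈ˡ xs → Spoke (u , v) → R u v
          spoke-R zero (suc v) e∈ _ = inj₂ (inj₁ refl , inj₂ (suc v , e∈ , refl))

        new : ∀ s t → (zero , s) ∈ˡ xs → (x , y) ≡ (zero , t) → Spoke (zero , s) → Spoke (zero , t) →
              tree t ≢ tree s
        new (suc w) (suc t) s∈ refl (w∈T , w∈A) (t∈T , t∈A) p
          with separated t∈T w∈T (t∈A , w∈A , gmap id (step-in (λ e∈ → e∈)) (tree⇒same p))
        ... | refl = contradiction s∈ (unique-++-∉ xs (subst Unique eq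
                (Unique.filter⁺ spoke? (Unique.cartesianProduct⁺ (Unique.allFin⁺ _) (Unique.allFin⁺ _)))))

        go : ∀ u v → (x , y) ≡ (u , v) → Spoke (u , v) → ¬ R u v
        go zero (suc t) _ _ (inj₁ p) = tree⇒same p
        go zero (suc t) _ _ (inj₂ (_ , inj₁ p)) = tree⇒same (sym p)
        go zero (suc t) xy st (inj₂ (_ , inj₂ (s , s∈ , p))) =
          new s (suc t) s∈ xy (spoke⁻ (subst ((zero , s) ∈ˡ_) (sym eq) (∈-++⁺ˡ s∈))) st p

-- Contexts that leave a piece untouched

Within : Subset n → Pred (Fin (suc n)) 0ℓ
Within A zero    = ⊤′
Within A (suc x) = x ∈ A

-- Holds for contexts built outside of `C`: they join the vertices of `C` to nothing.
Discrete : Colouring (suc n) → Subset n → Set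
Discrete c C = ∀ {x u} → x ∈ C → c (suc x) ≡ c u → suc x ≡ u

Discrete-mergeAll : ∀ {c : Colouring (suc n)} {C A} es → Discrete c C → Disjoint C A →
                    (∀ {x y} → (x , y) ∈ˡ es → Within A x × Within A y) → Discrete (mergeAll c es) C
Discrete-mergeAll {n} {c = c} {C} {A} es discrete disj within x∈ eq =
  proj₁ (mergeAll-least {R = R} R-equiv base joins eq) x∈ refl
  where
  -- Related vertices are equal as soon as one of them lies in `C`; edges inside `A` satisfy this
  -- vacuously.
  R : Rel (Fin (suc n)) 0ℓ
  R u v = (∀ {x} → x ∈ C → suc x ≡ u → suc x ≡ v) × (∀ {x} → x ∈ C → suc x ≡ v → suc x ≡ u)

  R-equiv : IsEquivalence R
  R-equiv = record
    { refl  = (λ _ p → p) , (λ _ p → p)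
    ; sym   = λ (f , g) → g , f
    ; trans = λ (f , g) (h , k) → (λ x∈ p → h x∈ (f x∈ p)) , (λ x∈ p → g x∈ (k x∈ p)) }

  base : ∀ {u v} → c u ≡ c v → R u v
  base eq = (λ { x∈ refl → discrete x∈ eq }) , (λ { x∈ refl → discrete x∈ (sym eq) })

  joins : ∀ {x y} → (x , y) ∈ˡ _ → R x y
  joins e∈ with within e∈
  ... | p , q = (λ { x∈ refl → contradiction p (disj x∈) }) , (λ { x∈ refl → contradiction q (disj x∈) })

-- Solutions, reducible labels and kernels

module _ {n : ℕ} (G : Graph n) where

  edges-within : ∀ {K T W x y} → (x , y) ∈ˡ edges G K T W → Within (K ∪ W) x × Within (K ∪ W) y
  edges-within {K} {T} {W} {x} {y} e∈ = go x y (∈-edges⁻ G e∈)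
    where
    go : ∀ x y → Live G K T W (x , y) → Within (K ∪ W) x × Within (K ∪ W) y
    go zero    (suc v) (_ , v∈) = _ , q⊆p∪q K W v∈
    go (suc u) (suc v) (_ , _ , inj₁ (u∈ , v∈)) = q⊆p∪q K W u∈ , q⊆p∪q K W v∈
    go (suc u) (suc v) (_ , _ , inj₂ (inj₁ (u∈ , v∈))) = q⊆p∪q K W u∈ , p⊆p∪q W v∈
    go (suc u) (suc v) (_ , _ , inj₂ (inj₂ (u∈ , v∈))) = p⊆p∪q W u∈ , q⊆p∪q K W v∈

  Live-relabel : ∀ {K T T′ W} → (∀ {x} → x ∈ W → x ∈ T → x ∈ T′) →
                 ∀ {e} → Live G K T W e → Live G K T′ W e
  Live-relabel h {zero  , suc v} (v∈T , v∈W) = h v∈W v∈T , v∈W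
  Live-relabel h {suc u , suc v} l           = l

  edges-relabel : ∀ {K T T′ W} → (∀ {x} → x ∈ W → x ∈ T → x ∈ T′) → edges G K T W ⊆ˡ edges G K T′ W
  edges-relabel h {e} e∈ = ∈-edges⁺ G {e = e} (Live-relabel h {e} (∈-edges⁻ G e∈))

  Indep-relabel : ∀ {c K T T′ W} → (∀ {x} → x ∈ W → x ∈ T → x ∈ T′) →
                  Indep c (edges G K T′ W) → Indep c (edges G K T W)
  Indep-relabel {K = K} {T} {T′} {W} h =
    Indep-filter (live? G K T′ W) (live? G K T W) (λ {e} → Live-relabel h {e}) (allPairs G)

  -- A feedback vertex set is represented by its complement W.
  Near : Subset n → Subset n → ℕ → Set
  Near C W b = ∀ Y → Y ⊆ C → Indep id (edges G ⊥ ⊥ Y) → ∣ Y ∣ ≤ ∣ W ∣ + b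

  -- The vertices of C outside W are deleted, those of K are kept, and the
  -- colouring c tells which of the latter (and zero) are already connected
  -- outside of C.
  record Solution (c : Colouring (suc n)) (K S T C W : Subset n) : Set where
    field
      inside-C : W ⊆ C
      avoids   : Disjoint S W
      acyclic  : Indep c (edges G K T W)
  open Solution public

  Solution-anti : ∀ {c K S S′ T T′ C W} → S′ ⊆ S → T′ ⊆ T → Solution c K S T C W → Solution c K S′ T′ C W
  Solution-anti S⊆ T⊆ s = record
    { inside-C = inside-C s
    ; avoids   = λ x∈ → avoids s (S⊆ x∈)
    ; acyclic  = Indep-edges-anti G (λ x∈ → x∈) T⊆ (λ x∈ → x∈) (acyclic s)
    }

  Solution-⊆ : ∀ {c K S T C C′ W} → W ⊆ C′ → Solution c K S T C W → Solution c K S T C′ W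
  Solution-⊆ W⊆ s = record { inside-C = W⊆ ; avoids = avoids s ; acyclic = acyclic s }

  acyclic-id : ∀ {c K S T C W} → Solution c K S T C W → Indep id (edges G ⊥ T W)
  acyclic-id {c} s = Indep-anti (⊑⁺ λ eq → cong c eq)
    (Indep-edges-anti G (λ x∈ → contradiction x∈ ∉⊥) (λ x∈ → x∈) (λ x∈ → x∈) (acyclic s))

  acyclic-⊥ : ∀ {c K S T C W} → Solution c K S T C W → Indep id (edges G ⊥ ⊥ W)
  acyclic-⊥ s = Indep-edges-anti G (λ x∈ → x∈) (λ x∈ → contradiction x∈ ∉⊥) (λ x∈ → x∈) (acyclic-id s)

  -- The context `c` is quantified inside, so the same `S′` and `T′` serve whatever is chosen
  -- outside of `C`. The slack `b` is measured against the largest acyclic subset of `C`, ignoring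
  -- labels and context.
  record Reducible (C K : Subset n) (b : ℕ) (S T S′ T′ : Subset n) : Set where
    field
      reduce : ∀ {c} → Discrete c C → ∀ {W} → Solution c K S′ T′ C W → Near C W b →
               ∃[ W′ ] (Solution c K S T C W′ × ∣ W ∣ ≤ ∣ W′ ∣)
  open Reducible public

  Reducible-mono : ∀ {C K b S T S′ S″ T′ T″} → S′ ⊆ S″ → T′ ⊆ T″ →
                   Reducible C K b S T S′ T′ → Reducible C K b S T S″ T″
  reduce (Reducible-mono S⊆ T⊆ r) discrete s near = reduce r discrete (Solution-anti S⊆ T⊆ s) near

  record Kernel (N : ℕ) (S T C K : Subset n) (b : ℕ) : Set where
    field
      {S′ T′}   : Subset n
      S′⊆S      : S′ ⊆ S
      T′⊆T      : T′ ⊆ T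
      ∣S′∣≤     : ∣ S′ ∣ ≤ N
      ∣T′∣≤     : ∣ T′ ∣ ≤ N
      reducible : Reducible C K b S T S′ T′

  Kernel-≤ : ∀ {M N S T C K b} → M ≤ N → Kernel M S T C K b → Kernel N S T C K b
  Kernel-≤ M≤N k = record
    { S′⊆S = S′⊆S ; T′⊆T = T′⊆T
    ; ∣S′∣≤ = ℕ.≤-trans ∣S′∣≤ M≤N ; ∣T′∣≤ = ℕ.≤-trans ∣T′∣≤ M≤N ; reducible = reducible }
    where open Kernel k

-- Classes of pieces with bounded kernels

Class : Set₁
Class = ∀ {n} → Graph n → Subset n → Subset n → Set

-- Quantified over all `k` and `b`, because moving a vertex to `K` raises both by one.
Bounded : Class → Set₁
Bounded 𝒞 = ∀ k b → ∃[ N ] (∀ {n} (G : Graph n) S T C K → 𝒞 G T C → Disjoint K C → ∣ K ∣ ≤ k →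
                            Kernel G N S T C K b)

_∪ᶜ_ : Class → Class → Class
(𝒞 ∪ᶜ 𝒟) G T C = 𝒞 G T C ⊎ 𝒟 G T C

Bounded-∪ : ∀ {𝒞 𝒟 : Class} → Bounded 𝒞 → Bounded 𝒟 → Bounded (𝒞 ∪ᶜ 𝒟)
Bounded-∪ f g k b with f k b | g k b
... | M , kernel | N , kernel′ = M + N , λ where
  G S T C K (inj₁ p) disj k≤ → Kernel-≤ G (ℕ.m≤m+n M N) (kernel G S T C K p disj k≤)
  G S T C K (inj₂ p) disj k≤ → Kernel-≤ G (ℕ.m≤n+m N M) (kernel′ G S T C K p disj k≤)

Bounded-⊆ : ∀ {𝒞 𝒟 : Class} → (∀ {n} (G : Graph n) T C → 𝒟 G T C → 𝒞 G T C) → Bounded 𝒞 → Bounded 𝒟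
Bounded-⊆ sub f k b with f k b
... | N , kernel = N , λ G S T C K p → kernel G S T C K (sub G T C p)

-- Deleting a vertex

Vertex : Class → Class
Vertex 𝒞 G T C = ∃[ v ] (v ∈ C × 𝒞 G T (C - v))

∪-disjoint-remove : ∀ {v} {C K : Subset n} → Disjoint K C → Disjoint (K ∪ ⁅ v ⁆) (C - v)
∪-disjoint-remove {v = v} {C} {K} disj x∈ x∈C with x∈p∪q⁻ K ⁅ v ⁆ x∈
... | inj₁ x∈K = disj x∈K (p─q⊆p C _ x∈C)
... | inj₂ x∈v = x∈p-y⇒x≢y C x∈C (x∈⁅y⁆⇒x≡y v x∈v)

module _ {n : ℕ} (G : Graph n) {S T C K : Subset n} {v : Fin n} {b : ℕ}
         (v∈C : v ∈ C) (disj : Disjoint K C) where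

  private
    -- `W` loses the vertex `v`, while the optimum of `C - v` may equal that of `C`; hence the
    -- additional unit of slack.
    near-remove : ∀ {W} → v ∈ W → Near G C W b → Near G (C - v) (W - v) (suc b)
    near-remove {W} v∈W near Y Y⊆ i = begin
      ∣ Y ∣                     ≤⟨ near Y (λ y∈ → p─q⊆p C _ (Y⊆ y∈)) i ⟩
      ∣ W ∣ + b                 ≡⟨ cong (_+ b) (∣split∣ (split-remove v∈W)) ⟩
      ∣ ⁅ v ⁆ ∣ + ∣ W - v ∣ + b ≡⟨ cong (λ z → z + ∣ W - v ∣ + b) (∣⁅x⁆∣≡1 v) ⟩
      suc (∣ W - v ∣ + b)       ≡⟨ ℕ.+-suc _ b ⟨
      ∣ W - v ∣ + suc b         ∎
      where open ℕ.≤-Reasoning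

  -- If `W` avoids `v`, it is a solution in `C - v`. Otherwise `v` joins `K` and its edges join the
  -- context; the labels of `v` itself must be present for `v` to be kept legally and with the right
  -- edges.
  Reducible-remove : ∀ {S₀ T₀} → (v ∈ S → v ∈ S₀) → (v ∈ T → v ∈ T₀) →
                     Reducible G (C - v) K b S T S₀ T₀ →
                     Reducible G (C - v) (K ∪ ⁅ v ⁆) (suc b) S T S₀ T₀ →
                     Reducible G C K b S T S₀ T₀
  reduce (Reducible-remove {S₀} {T₀} S₀∋v T₀∋v r₁ r₂) {c} discrete {W} s near with v ∈? W
  ... | no v∉W =
    let W⊆ = λ {x} x∈ → x∈p∧x≢y⇒x∈p-y {x = x} (inside-C s x∈) (λ eq → v∉W (subst (_∈ W) eq x∈))
        W′ , s′ , W≤ = reduce r₁ (λ x∈ → discrete (p─q⊆p C _ x∈)) (Solution-⊆ G W⊆ s)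
                        (λ Y Y⊆ → near Y (λ y∈ → p─q⊆p C _ (Y⊆ y∈)))
    in W′ , Solution-⊆ G (λ x∈ → p─q⊆p C _ (inside-C s′ x∈)) s′ , W≤
  ... | yes v∈W with Indep-split⁻ G (λ x∈K x∈W → disj x∈K (inside-C s x∈W)) (split-remove v∈W) (acyclic s)
  ...   | i₁ , i₂ with reduce r₂ discrete₁ s₁ (near-remove v∈W near)
    where
    discrete₁ : Discrete (mergeAll c (edges G K T₀ ⁅ v ⁆)) (C - v)
    discrete₁ = Discrete-mergeAll (edges G K T₀ ⁅ v ⁆) (λ x∈ → discrete (p─q⊆p C _ x∈))
      (λ x∈ x∈′ → ∪-disjoint-remove disj x∈′ x∈) (edges-within G)

    s₁ : Solution G (mergeAll c (edges G K T₀ ⁅ v ⁆)) (K ∪ ⁅ v ⁆) S₀ T₀ (C - v) (W - v)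
    s₁ = record
      { inside-C = λ x∈ → x∈p∧x≢y⇒x∈p-y (inside-C s (p─q⊆p W _ x∈)) (x∈p-y⇒x≢y W x∈)
      ; avoids   = λ x∈ x∈′ → avoids s x∈ (p─q⊆p W _ x∈′)
      ; acyclic  = i₂ }
  ...     | W₂ , s₂ , W≤ = ⁅ v ⁆ ∪ W₂ , record
    { inside-C = inside-C′
    ; avoids   = avoids′
    ; acyclic  = Indep-split⁺ G (λ x∈K x∈ → disj x∈K (inside-C′ x∈)) (split-∪ new)
                   (Indep-relabel G T-v i₁)
                   (Indep-anti fewer (acyclic s₂))
    } , size
    where
    T-v : ∀ {x} → x ∈ ⁅ v ⁆ → x ∈ T → x ∈ T₀
    T-v x∈ with refl ← x∈⁅y⁆⇒x≡y v x∈ = T₀∋v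

    -- The label of `v` agrees in `T` and `T₀`, so the context for the full labels is no coarser.
    fewer : mergeAll c (edges G K T ⁅ v ⁆) ⊑ mergeAll c (edges G K T₀ ⁅ v ⁆)
    fewer = mergeAll-mono {c = c} {es = edges G K T ⁅ v ⁆} {fs = edges G K T₀ ⁅ v ⁆}
              ⊑-refl (edges-relabel G T-v)

    new : Disjoint ⁅ v ⁆ W₂
    new x∈ x∈′ = x∈p-y⇒x≢y C (inside-C s₂ x∈′) (x∈⁅y⁆⇒x≡y v x∈)

    inside-C′ : ⁅ v ⁆ ∪ W₂ ⊆ C
    inside-C′ x∈ with x∈p∪q⁻ ⁅ v ⁆ W₂ x∈
    ... | inj₁ x∈v = subst (_∈ C) (sym (x∈⁅y⁆⇒x≡y v x∈v)) v∈C
    ... | inj₂ x∈W₂ = p─q⊆p C _ (inside-C s₂ x∈W₂)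

    avoids′ : Disjoint S (⁅ v ⁆ ∪ W₂)
    avoids′ x∈S x∈ with x∈p∪q⁻ ⁅ v ⁆ W₂ x∈
    ... | inj₁ x∈v with refl ← x∈⁅y⁆⇒x≡y v x∈v = avoids s (S₀∋v x∈S) v∈W
    ... | inj₂ x∈W₂ = avoids s₂ x∈S x∈W₂

    size : ∣ W ∣ ≤ ∣ ⁅ v ⁆ ∪ W₂ ∣
    size = begin
      ∣ W ∣                 ≡⟨ ∣split∣ (split-remove v∈W) ⟩
      ∣ ⁅ v ⁆ ∣ + ∣ W - v ∣ ≤⟨ ℕ.+-monoʳ-≤ ∣ ⁅ v ⁆ ∣ W≤ ⟩
      ∣ ⁅ v ⁆ ∣ + ∣ W₂ ∣    ≡⟨ ∣split∣ (split-∪ new) ⟨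
      ∣ ⁅ v ⁆ ∪ W₂ ∣        ∎
      where open ℕ.≤-Reasoning

∪∪⊆ : ∀ {p q r s : Subset n} → p ⊆ s → q ⊆ s → r ⊆ s → p ∪ q ∪ r ⊆ s
∪∪⊆ {p = p} {q} {r} p⊆ q⊆ r⊆ x∈ with x∈p∪q⁻ p (q ∪ r) x∈
... | inj₁ x∈p = p⊆ x∈p
... | inj₂ x∈′ with x∈p∪q⁻ q r x∈′
...   | inj₁ x∈q = q⊆ x∈q
...   | inj₂ x∈r = r⊆ x∈r

∣∪∪∣≤ : ∀ (p q r : Subset n) {i j k} → ∣ p ∣ ≤ i → ∣ q ∣ ≤ j → ∣ r ∣ ≤ k → ∣ p ∪ q ∪ r ∣ ≤ i + (j + k)
∣∪∪∣≤ p q r p≤ q≤ r≤ =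
  ℕ.≤-trans (∣p∪q∣≤∣p∣+∣q∣ p (q ∪ r)) (ℕ.+-mono-≤ p≤ (ℕ.≤-trans (∣p∪q∣≤∣p∣+∣q∣ q r) (ℕ.+-mono-≤ q≤ r≤)))

Bounded-Vertex : ∀ {𝒞 : Class} → Bounded 𝒞 → Bounded (Vertex 𝒞)
Bounded-Vertex f k b with f k b | f (suc k) (suc b)
-- `N₁` labels for `v` deleted, `N₂` for `v` kept, and one for `v` itself.
... | N₁ , kernel₁ | N₂ , kernel₂ = N₁ + (N₂ + 1) , λ where
  G S T C K (v , v∈C , p) disj k≤ →
    let open Kernel
        k₁ = kernel₁ G S T (C - v) K p (λ x∈K x∈C → disj x∈K (p─q⊆p C _ x∈C)) k≤
        k₂ = kernel₂ G S T (C - v) (K ∪ ⁅ v ⁆) p (∪-disjoint-remove disj)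
               (ℕ.≤-trans (∣p∪q∣≤∣p∣+∣q∣ K ⁅ v ⁆)
                 (subst (∣ K ∣ + ∣ ⁅ v ⁆ ∣ ≤_) (ℕ.+-comm k 1)
                   (ℕ.+-mono-≤ k≤ (ℕ.≤-reflexive (∣⁅x⁆∣≡1 v)))))
        single = λ A → ℕ.≤-trans (∣p∩q∣≤∣p∣ ⁅ v ⁆ A) (ℕ.≤-reflexive (∣⁅x⁆∣≡1 v))
    in record
    { S′        = S′ k₁ ∪ S′ k₂ ∪ (⁅ v ⁆ ∩ S)
    ; T′        = T′ k₁ ∪ T′ k₂ ∪ (⁅ v ⁆ ∩ T)
    ; S′⊆S      = ∪∪⊆ (S′⊆S k₁) (S′⊆S k₂) (p∩q⊆q ⁅ v ⁆ S)
    ; T′⊆T      = ∪∪⊆ (T′⊆T k₁) (T′⊆T k₂) (p∩q⊆q ⁅ v ⁆ T)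
    ; ∣S′∣≤     = ∣∪∪∣≤ (S′ k₁) (S′ k₂) _ (∣S′∣≤ k₁) (∣S′∣≤ k₂) (single S)
    ; ∣T′∣≤     = ∣∪∪∣≤ (T′ k₁) (T′ k₂) _ (∣T′∣≤ k₁) (∣T′∣≤ k₂) (single T)
    ; reducible = Reducible-remove G v∈C disj
        (λ v∈S → q⊆p∪q (S′ k₁) _ (q⊆p∪q (S′ k₂) _ (x∈p∩q⁺ (x∈⁅x⁆ v , v∈S))))
        (λ v∈T → q⊆p∪q (T′ k₁) _ (q⊆p∪q (T′ k₂) _ (x∈p∩q⁺ (x∈⁅x⁆ v , v∈T))))
        (Reducible-mono G (p⊆p∪q _) (p⊆p∪q _) (reducible k₁))
        (Reducible-mono G (λ x∈ → q⊆p∪q (S′ k₁) _ (p⊆p∪q _ x∈)) (λ x∈ → q⊆p∪q (T′ k₁) _ (p⊆p∪q _ x∈))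
          (reducible k₂))
    }

-- Closed sets, components and slack

module _ {n : ℕ} (G : Graph n) where

  open Graph G

  -- `D` is a union of components of `G[A]`. This notion survives the removal of other such sets
  -- from `A`, which the inductions over lists of components need.
  record ClosedIn (A D : Subset n) : Set where
    field
      subset : D ⊆ A
      closed : ∀ {x y} → x ∈ D → y ∈ A → Adj x y → y ∈ D
  open ClosedIn public

  ClosedIn-─ : ∀ {A D E} → ClosedIn A E → Disjoint D E → ClosedIn (A ─ D) E
  ClosedIn-─ {A} {D} cl disj = record
    { subset = λ x∈ → x∈p∧x∉q⇒x∈p─q (subset cl x∈) (λ x∈D → disj x∈D x∈)
    ; closed = λ x∈ y∈ → closed cl x∈ (p─q⊆p A D y∈) }

  All-ClosedIn-─ : ∀ {A D Es} → All (ClosedIn A) Es → All (Disjoint D) Es → All (ClosedIn (A ─ D)) Es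
  All-ClosedIn-─ []         []       = []
  All-ClosedIn-─ (cl ∷ cls) (p ∷ ps) = ClosedIn-─ cl p ∷ All-ClosedIn-─ cls ps

  closed-apart : ∀ {A D X Y} → ClosedIn A D → X ⊆ D → Y ⊆ A ─ D → Apart G X Y
  closed-apart {A} {D} cl X⊆ Y⊆ x∈ y∈ a =
    x∈p─q⇒x∉q A D (Y⊆ y∈) (closed cl (X⊆ x∈) (p─q⊆p A D (Y⊆ y∈)) a)

  Joined-closed : ∀ {A D u v} → ClosedIn A D → Joined G A u v → u ∈ D → Joined G D u v
  Joined-closed {A} {D} cl (_ , _ , p) u∈ = go p u∈
    where
    go : ∀ {u v} → Star (AdjIn G A) u v → u ∈ D → Joined G D u v
    go ε u∈ = Joined-refl G u∈
    go ((_ , w∈ , a) ◅ p) u∈ with go p (closed cl u∈ w∈ a)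
    ... | w∈D , v∈ , q = u∈ , v∈ , (u∈ , w∈D , a) ◅ q

  component-closed : ∀ {A u} → ClosedIn A (component G A u)
  component-closed {A} {u} = record
    { subset = λ x∈ → proj₁ (proj₂ (∈-component⁻ G {v = u} x∈))
    ; closed = λ x∈ y∈ a → let j@(_ , x∈A , _) = ∈-component⁻ G {v = u} x∈ in
        ∈-component⁺ G (Joined-trans G j (x∈A , y∈ , (x∈A , y∈ , a) ◅ ε)) }

  cc-closed : ∀ {A D} → D ∈ˡ cc G A → ClosedIn A D
  cc-closed D∈ with u , _ , refl ← ∈-cc⁻ G D∈ = component-closed {u = u}

  cc-joined : ∀ {A D u v} → D ∈ˡ cc G A → u ∈ D → v ∈ D → Joined G D u v
  cc-joined D∈ u∈ v∈ with w , _ , refl ← ∈-cc⁻ G D∈ =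
    Joined-closed (cc-closed D∈)
      (Joined-trans G (Joined-sym G (∈-component⁻ G {v = w} u∈)) (∈-component⁻ G {v = w} v∈)) u∈

  cc-disjoint : ∀ A → AllPairs Disjoint (cc G A)
  cc-disjoint A = pairs (cc G A) (deduplicate-! (≡-dec Bool._≟_) (map (component G A) (elements A))) (λ D∈ → D∈)
    where
    disjoint : ∀ {D E} → D ∈ˡ cc G A → E ∈ˡ cc G A → D ≢ E → Disjoint D E
    disjoint D∈ E∈ D≢E x∈D x∈E with ∈-cc⁻ G D∈ | ∈-cc⁻ G E∈
    ... | u , _ , refl | v , _ , refl =
      D≢E (component-cong G
        (Joined-trans G (∈-component⁻ G {v = u} x∈D) (Joined-sym G (∈-component⁻ G {v = v} x∈E))))

    pairs : ∀ Ds → Unique Ds → Ds ⊆ˡ cc G A → AllPairs Disjoint Ds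
    pairs []       _             _   = []
    pairs (D ∷ Ds) (D∉ ∷ unique) Ds⊆ =
      All.tabulate (λ E∈ → disjoint (Ds⊆ (here refl)) (Ds⊆ (there E∈)) (All.lookup D∉ E∈))
      ∷ pairs Ds unique (λ E∈ → Ds⊆ (there E∈))

  near? : ∀ C W b → Near G C W b ⊎ ∃[ Y ] (Y ⊆ C × Indep id (edges G ⊥ ⊥ Y) × ∣ W ∣ + b < ∣ Y ∣)
  near? C W b with anySubset? (λ Y → (Y ⊆? C) ×-dec indep? id (edges G ⊥ ⊥ Y) ×-dec (∣ W ∣ + b ℕ.<? ∣ Y ∣))
  ... | yes better = inj₂ better
  ... | no ¬better = inj₁ λ Y Y⊆ i → ℕ.≮⇒≥ λ < → ¬better (Y , Y⊆ , i , <)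

  Discrete-id : ∀ {C : Subset n} → Discrete id C
  Discrete-id _ eq = eq

  -- Joining all of `K` to `zero` is the coarsest that a context discrete on `W` can be, so
  -- independence there implies it in every such context.
  Indep-hub : ∀ {c d K T W} → Discrete c W → (∀ {x} → x ∈ K → d (suc x) ≡ d zero) →
              Indep d (edges G K T W) → Indep c (edges G K T W)
  Indep-hub {c} {d} {K} {T} {W} discrete hub = Indep-anti-on (edges-within G) (λ {u} {v} → below u v)
    where
    to-zero : ∀ u → Within (K ∪ W) u → d u ≡ d zero ⊎ ∃[ x ] (u ≡ suc x × x ∈ W)
    to-zero zero    _  = inj₁ refl
    to-zero (suc x) x∈ with x∈p∪q⁻ K W x∈
    ... | inj₁ x∈K = inj₁ (hub x∈K)
    ... | inj₂ x∈W = inj₂ (x , refl , x∈W)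

    below : ∀ u v → Within (K ∪ W) u → Within (K ∪ W) v → c u ≡ c v → d u ≡ d v
    below u v u∈ v∈ eq with to-zero u u∈ | to-zero v v∈
    ... | inj₂ (x , refl , x∈) | _ = cong d (discrete x∈ eq)
    ... | inj₁ _ | inj₂ (y , refl , y∈) = cong d (sym (discrete y∈ (sym eq)))
    ... | inj₁ p | inj₁ q = trans p (sym q)

  -- No edges run between `D` and `A ─ D`, so `Y ∪ Z` is again acyclic and competes with `W`.
  near-union : ∀ {A D W Y Z b} → ClosedIn A D → Near G A W b →
               Y ⊆ D → Indep id (edges G ⊥ ⊥ Y) → Z ⊆ A ─ D → Indep id (edges G ⊥ ⊥ Z) →
               ∣ Y ∣ + ∣ Z ∣ ≤ ∣ W ∣ + b
  near-union {A} {D} {W} {Y} {Z} {b} cl near Y⊆ i Z⊆ j =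
    subst (_≤ ∣ W ∣ + b) (∣split∣ s) (near (Y ∪ Z) Y∪Z⊆
      (Indep-apart⁺ G (λ x∈ → contradiction x∈ ∉⊥) s (closed-apart cl Y⊆ Z⊆) i
        (Indep-hub discrete (λ x∈ → contradiction x∈ ∉⊥) j)))
    where
    disj : Disjoint Y Z
    disj x∈ x∈′ = x∈p─q⇒x∉q A D (Z⊆ x∈′) (Y⊆ x∈)

    s : IsSplit (Y ∪ Z) Y Z
    s = split-∪ disj

    Y∪Z⊆ : Y ∪ Z ⊆ A
    Y∪Z⊆ x∈ with x∈p∪q⁻ Y Z x∈
    ... | inj₁ x∈Y = subset cl (Y⊆ x∈Y)
    ... | inj₂ x∈Z = p─q⊆p A D (Z⊆ x∈Z)

    discrete : Discrete (mergeAll id (edges G ⊥ ⊥ Y)) Z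
    discrete = Discrete-mergeAll (edges G ⊥ ⊥ Y) Discrete-id away (edges-within G)
      where
      away : Disjoint Z (⊥ ∪ Y)
      away x∈ x∈′ with x∈p∪q⁻ ⊥ Y x∈′
      ... | inj₁ x∈⊥ = ∉⊥ x∈⊥
      ... | inj₂ x∈Y = disj x∈Y x∈

  module _ {A D W : Subset n} {b : ℕ} (cl : ClosedIn A D) (near : Near G A W b) (W⊆ : W ⊆ A)
           (i : Indep id (edges G ⊥ ⊥ W)) where

    private
      W─D⊆ : W ─ D ⊆ A ─ D
      W─D⊆ x∈ = x∈p∧x∉q⇒x∈p─q (W⊆ (p─q⊆p W D x∈)) (x∈p─q⇒x∉q W D x∈)

      sub : ∀ {V} → V ⊆ W → Indep id (edges G ⊥ ⊥ V)
      sub V⊆ = Indep-edges-anti G (λ x∈ → x∈) (λ x∈ → x∈) V⊆ i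

      ∣W∣ : ∣ W ∣ + b ≡ ∣ W ∩ D ∣ + (∣ W ─ D ∣ + b)
      ∣W∣ = trans (cong (_+ b) (∣split∣ (split-∩─ W D))) (ℕ.+-assoc ∣ W ∩ D ∣ _ b)

    -- Exchange the part of `W` in `D` for `Y` and keep the rest.
    near-∩ : Near G D (W ∩ D) b
    near-∩ Y Y⊆ j = ℕ.+-cancelʳ-≤ ∣ W ─ D ∣ _ _ (begin
      ∣ Y ∣ + ∣ W ─ D ∣               ≤⟨ near-union {W = W} {b = b} cl near Y⊆ j W─D⊆ (sub (p─q⊆p W D)) ⟩
      ∣ W ∣ + b                       ≡⟨ ∣W∣ ⟩
      ∣ W ∩ D ∣ + (∣ W ─ D ∣ + b)     ≡⟨ cong (∣ W ∩ D ∣ +_) (ℕ.+-comm ∣ W ─ D ∣ b) ⟩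
      ∣ W ∩ D ∣ + (b + ∣ W ─ D ∣)     ≡⟨ ℕ.+-assoc ∣ W ∩ D ∣ b _ ⟨
      ∣ W ∩ D ∣ + b + ∣ W ─ D ∣       ∎)
      where open ℕ.≤-Reasoning

    -- The amount by which `Y` beats `W` inside `D` is no longer available as slack in the rest.
    near-─′ : ∀ {Y} → Y ⊆ D → Indep id (edges G ⊥ ⊥ Y) → ∀ {b′} → ∣ W ∩ D ∣ + b ≤ ∣ Y ∣ + b′ →
              Near G (A ─ D) (W ─ D) b′
    near-─′ {Y} Y⊆ j {b′} ≤Y Z Z⊆ k = ℕ.+-cancelˡ-≤ ∣ Y ∣ _ _ (begin
      ∣ Y ∣ + ∣ Z ∣               ≤⟨ near-union {W = W} {b = b} cl near Y⊆ j Z⊆ k ⟩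
      ∣ W ∣ + b                   ≡⟨ ∣W∣ ⟩
      ∣ W ∩ D ∣ + (∣ W ─ D ∣ + b) ≡⟨ swap ∣ W ∩ D ∣ ∣ W ─ D ∣ b ⟩
      ∣ W ─ D ∣ + (∣ W ∩ D ∣ + b) ≤⟨ ℕ.+-monoʳ-≤ ∣ W ─ D ∣ ≤Y ⟩
      ∣ W ─ D ∣ + (∣ Y ∣ + b′)    ≡⟨ swap ∣ W ─ D ∣ ∣ Y ∣ b′ ⟩
      ∣ Y ∣ + (∣ W ─ D ∣ + b′)    ∎)
      where
      open ℕ.≤-Reasoning
      swap : ∀ x y z → x + (y + z) ≡ y + (x + z)
      swap x y z = trans (sym (ℕ.+-assoc x y z)) (trans (cong (_+ z) (ℕ.+-comm x y)) (ℕ.+-assoc y x z))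

    near-─ : Near G (A ─ D) (W ─ D) b
    near-─ = near-─′ (p∩q⊆q W D) (sub (p∩q⊆p W D)) ℕ.≤-refl

  Solution-restrict : ∀ {c K S T A A′ W W′} → W′ ⊆ W → W′ ⊆ A′ → Solution G c K S T A W →
                      ∀ {d} → Indep d (edges G K T W′) → Solution G d K S T A′ W′
  Solution-restrict W′⊆W W′⊆A′ s i = record
    { inside-C = W′⊆A′ ; avoids = λ x∈ x∈′ → avoids s x∈ (W′⊆W x∈′) ; acyclic = i }

  ─-mono : ∀ {W A} (D : Subset n) → W ⊆ A → W ─ D ⊆ A ─ D
  ─-mono {W} D W⊆ x∈ = x∈p∧x∉q⇒x∈p─q (W⊆ (p─q⊆p W D x∈)) (x∈p─q⇒x∉q W D x∈)

  -- Each closed set in which W cannot be optimal over the pairs ps either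
  -- costs one unit of the slack b or uses up one of these pairs.
  rank : ∀ {K S T A W c b} Ds ps → All (ClosedIn A) Ds → AllPairs Disjoint Ds → Disjoint K A →
         Solution G c K S T A W → Near G A W b →
         All (λ D → ∀ {V} → Solution G (mergeAll c ps) K S T D V → ¬ Near G D V 0) Ds →
         length Ds ≤ b + length ps
  rank [] _ _ _ _ _ _ _ = z≤n
  rank {K} {S} {T} {A} {W} {c} {b} (D ∷ Ds) ps (cl ∷ cls) (dj ∷ djs) disj s near (bad ∷ bads)
    with Indep-apart⁻ G (λ x∈ x∈′ → disj x∈ (inside-C s x∈′)) (split-∩─ W D) (acyclic s) | near? D (W ∩ D) 0
  -- `W ∩ D` is optimal, so it cannot stay independent after `ps`; the exchange lets its edges take
  -- the place of one pair.
  ... | i₁ , i₂ | inj₁ opt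
    with Indep-exchange ps i₁ (λ i → bad (Solution-restrict (p∩q⊆p W D) (p∩q⊆q W D) s i) opt)
  ...   | qs , len , ps⊑qs = subst (suc (length Ds) ≤_) (trans (sym (ℕ.+-suc b _)) (cong (b +_) (sym len)))
    (s≤s (rank Ds qs (All-ClosedIn-─ cls dj) djs
           (λ x∈ x∈′ → disj x∈ (p─q⊆p A D x∈′))
           (Solution-restrict (p─q⊆p W D) (─-mono D (inside-C s)) s i₂)
           (near-─ cl near (inside-C s) (acyclic-⊥ G s))
           (All.map (λ bad′ {V} t →
             bad′ (Solution-restrict (λ x∈ → x∈) (inside-C t) t (Indep-anti ps⊑qs (acyclic t)))) bads)))
  rank {K} {S} {T} {A} {W} {c} {b} (D ∷ Ds) ps (cl ∷ cls) (dj ∷ djs) disj s near (bad ∷ bads)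
    | i₁ , i₂ | inj₂ (Y , Y⊆ , j , <Y) = lose b near
    where
    -- `Y` beats `W ∩ D` by at least one vertex, which uses a unit of slack and is impossible for
    -- slack 0.
    lose : ∀ b → Near G A W b → suc (length Ds) ≤ b + length ps
    lose zero near = contradiction <Y (ℕ.≤⇒≯ (near-∩ cl near (inside-C s) (acyclic-⊥ G s) Y Y⊆ j))
    lose (suc b) near = s≤s (rank Ds ps (All-ClosedIn-─ cls dj) djs
      (λ x∈ x∈′ → disj x∈ (p─q⊆p A D x∈′))
      (Solution-restrict (p─q⊆p W D) (─-mono D (inside-C s)) s
        (Indep-anti (mergeAll-⊑ c (edges G K T (W ∩ D))) i₂))
      (near-─′ cl near (inside-C s) (acyclic-⊥ G s) Y⊆ j
        (subst (_≤ ∣ Y ∣ + b) (sym (ℕ.+-suc ∣ W ∩ D ∣ b))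
          (ℕ.+-monoˡ-≤ b (subst (_< ∣ Y ∣) (ℕ.+-identityʳ _) <Y))))
      bads)

  -- Good and bad components

  star : Subset n → List (Edge (suc n))
  star K = map (λ x → zero , suc x) (elements K)

  star-within : ∀ {K x y} → (x , y) ∈ˡ star K → Within K x × Within K y
  star-within {K} e∈ with ∈-map⁻ _ e∈
  ... | _ , x∈ , refl = _ , ∈-elements⁻ x∈

  length-star : ∀ K → length (star K) ≤ ∣ K ∣
  length-star K = subst (_≤ ∣ K ∣) (sym (length-map _ (elements K)))
    (Unique⇒length≤ (All.tabulate ∈-elements⁻) (Unique.filter⁺ (_∈? K) (Unique.allFin⁺ n)))

  -- The coarsest context on `K`, generated by at most `∣ K ∣` edges; their number bounds how often
  -- classes can be merged.
  hub : Subset n → Colouring (suc n)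
  hub K = mergeAll id (star K)

  hub-joins : ∀ {K x} → x ∈ K → hub K (suc x) ≡ hub K zero
  hub-joins {K} x∈ = sym (mergeAll-joins id (∈-map⁺ _ (∈-elements⁺ x∈)))

  -- A solution that keeps zero and the vertices of K separated from each other
  -- within D fits every context, so the labels of a good part are irrelevant.
  Good : (K S T D : Subset n) → Set
  Good K S T D = ∃[ W ] (Solution G (hub K) K S T D W × Near G D W 0)

  good? : ∀ K S T D → Dec (Good K S T D)
  good? K S T D = anySubset? λ W → solution? W ×-dec optimal? W
    where
    optimal? : ∀ W → Dec (Near G D W 0)
    optimal? W with near? D W 0
    ... | inj₁ opt                = yes opt
    ... | inj₂ (Y , Y⊆ , i , <Y) = no λ opt → ℕ.<⇒≱ <Y (opt Y Y⊆ i)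

    solution? : ∀ W → Dec (Solution G (hub K) K S T D W)
    solution? W with W ⊆? D | any? (λ x → (x ∈? S) ×-dec (x ∈? W)) | indep? (hub K) (edges G K T W)
    ... | yes W⊆D | no disj | yes i =
      yes record { inside-C = W⊆D ; avoids = λ x∈ x∈′ → disj (_ , x∈ , x∈′) ; acyclic = i }
    ... | no ¬W⊆D | _ | _ = no λ s → ¬W⊆D (inside-C s)
    ... | _ | yes (_ , x∈ , x∈′) | _ = no λ s → avoids s x∈ x∈′
    ... | _ | _ | no ¬i = no λ s → ¬i (acyclic s)

  -- The closed sets are treated one at a time: the part of the solution in `D` is exchanged while
  -- the rest, still for the reduced labels, serves as its context.
  replace : ∀ {K S S′ T T′ A W c b} Ds → All (ClosedIn A) Ds → AllPairs Disjoint Ds → Disjoint K A →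
            (∀ {x} → x ∈ A → ∃[ D ] (D ∈ˡ Ds × x ∈ D)) →
            All (λ D → Good K S T D ⊎ Reducible G D K b S T S′ T′) Ds → Discrete c A →
            Solution G c K S′ T′ A W → Near G A W b →
            ∃[ W′ ] (Solution G c K S T A W′ × ∣ W ∣ ≤ ∣ W′ ∣)
  replace {W = W} [] _ _ _ cover _ _ s _ = W , record
    { inside-C = inside-C s
    ; avoids   = λ _ x∈ → void x∈
    ; acyclic  = Indep-relabel G (λ x∈ → ⊥-elim (void x∈)) (acyclic s) } , ℕ.≤-refl
    where
    void : ∀ {x} → x ∉ W
    void x∈ with cover (inside-C s x∈)
    ... | _ , () , _
  replace {K} {S} {S′} {T} {T′} {A} {W} {c} {b}
          (D ∷ Ds) (cl ∷ cls) (dj ∷ djs) disj cover (red ∷ reds) discrete s near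
    -- `W ─ D` comes first in the split, so that its edges form the context of `W ∩ D`.
    with Indep-apart⁻ G (λ x∈ x∈′ → disj x∈ (inside-C s x∈′)) (split-sym (split-∩─ W D)) (acyclic s)
  ... | i₁ , i₂ = W₁ ∪ W₂ , record
      { inside-C = inside-C′
      ; avoids   = avoids′
      ; acyclic  = Indep-apart⁺ G (λ x∈ x∈′ → disj x∈ (inside-C′ x∈′)) sp
                     (closed-apart cl (inside-C s₁) (inside-C s₂)) j₁ (acyclic s₂) } , size
    where
    c′ : Colouring (suc n)
    c′ = mergeAll c (edges G K T′ (W ─ D))

    s-D : Solution G c′ K S′ T′ D (W ∩ D)
    s-D = Solution-restrict (p∩q⊆p W D) (p∩q⊆q W D) s i₂

    discrete-D : Discrete c′ D
    discrete-D = Discrete-mergeAll (edges G K T′ (W ─ D)) (λ x∈ → discrete (subset cl x∈)) away (edges-within G)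
      where
      away : Disjoint D (K ∪ (W ─ D))
      away x∈ x∈′ with x∈p∪q⁻ K (W ─ D) x∈′
      ... | inj₁ x∈K = disj x∈K (subset cl x∈)
      ... | inj₂ x∈W = x∈p─q⇒x∉q W D x∈W x∈

    solve : Good K S T D ⊎ Reducible G D K b S T S′ T′ →
            ∃[ W₁ ] (Solution G c′ K S T D W₁ × ∣ W ∩ D ∣ ≤ ∣ W₁ ∣)
    solve (inj₂ r) = reduce r discrete-D s-D (near-∩ cl near (inside-C s) (acyclic-⊥ G s))
    -- A good part forgets `W ∩ D`: its hub solution fits `c′` and, being optimal, is at least as
    -- large.
    solve (inj₁ (V , t , opt)) = V , Solution-restrict (λ x∈ → x∈) (inside-C t) t
      (Indep-hub (λ x∈ → discrete-D (inside-C t x∈)) hub-joins (acyclic t)) ,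
      subst (∣ W ∩ D ∣ ≤_) (ℕ.+-identityʳ _) (opt (W ∩ D) (inside-C s-D) (acyclic-⊥ G s-D))

    W₁ = proj₁ (solve red)
    s₁ = proj₁ (proj₂ (solve red))

    -- The new part is moved to the front and becomes context for the remaining closed sets.
    swapped : Indep c (edges G K T W₁) × Indep (mergeAll c (edges G K T W₁)) (edges G K T′ (W ─ D))
    swapped = Indep-++⁻ (edges G K T W₁) (Indep-++-comm (edges G K T′ (W ─ D)) (Indep-++⁺ i₁ (acyclic s₁)))

    j₁ = proj₁ swapped

    discrete-rest : Discrete (mergeAll c (edges G K T W₁)) (A ─ D)
    discrete-rest = Discrete-mergeAll (edges G K T W₁) (λ x∈ → discrete (p─q⊆p A D x∈)) away (edges-within G)
      where
      away : Disjoint (A ─ D) (K ∪ W₁)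
      away x∈ x∈′ with x∈p∪q⁻ K W₁ x∈′
      ... | inj₁ x∈K = disj x∈K (p─q⊆p A D x∈)
      ... | inj₂ x∈W = x∈p─q⇒x∉q A D x∈ (inside-C s₁ x∈W)

    cover-rest : ∀ {x} → x ∈ A ─ D → ∃[ E ] (E ∈ˡ Ds × x ∈ E)
    cover-rest x∈ with cover (p─q⊆p A D x∈)
    ... | _ , here refl , x∈D = contradiction x∈D (x∈p─q⇒x∉q A D x∈)
    ... | E , there E∈ , x∈E  = E , E∈ , x∈E

    rest : ∃[ W₂ ] (Solution G (mergeAll c (edges G K T W₁)) K S T (A ─ D) W₂ × ∣ W ─ D ∣ ≤ ∣ W₂ ∣)
    rest = replace Ds (All-ClosedIn-─ cls dj) djs
      (λ x∈ x∈′ → disj x∈ (p─q⊆p A D x∈′)) cover-rest reds discrete-rest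
      (Solution-restrict (p─q⊆p W D) (─-mono D (inside-C s)) s (proj₂ swapped))
      (near-─ cl near (inside-C s) (acyclic-⊥ G s))

    W₂ = proj₁ rest
    s₂ = proj₁ (proj₂ rest)

    sp : IsSplit (W₁ ∪ W₂) W₁ W₂
    sp = split-∪ λ x∈ x∈′ → x∈p─q⇒x∉q A D (inside-C s₂ x∈′) (inside-C s₁ x∈)

    inside-C′ : W₁ ∪ W₂ ⊆ A
    inside-C′ x∈ with x∈p∪q⁻ W₁ W₂ x∈
    ... | inj₁ x∈₁ = subset cl (inside-C s₁ x∈₁)
    ... | inj₂ x∈₂ = p─q⊆p A D (inside-C s₂ x∈₂)

    avoids′ : Disjoint S (W₁ ∪ W₂)
    avoids′ x∈S x∈ with x∈p∪q⁻ W₁ W₂ x∈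
    ... | inj₁ x∈₁ = avoids s₁ x∈S x∈₁
    ... | inj₂ x∈₂ = avoids s₂ x∈S x∈₂

    size : ∣ W ∣ ≤ ∣ W₁ ∪ W₂ ∣
    size = begin
      ∣ W ∣                 ≡⟨ ∣split∣ (split-∩─ W D) ⟩
      ∣ W ∩ D ∣ + ∣ W ─ D ∣ ≤⟨ ℕ.+-mono-≤ (proj₂ (proj₂ (solve red))) (proj₂ (proj₂ rest)) ⟩
      ∣ W₁ ∣ + ∣ W₂ ∣       ≡⟨ ∣split∣ sp ⟨
      ∣ W₁ ∪ W₂ ∣           ∎
      where open ℕ.≤-Reasoning

  collect : ∀ {N S T K b} Ds → (∀ {D} → D ∈ˡ Ds → Kernel G N S T D K b) →
            ∃[ S′ ] ∃[ T′ ] (S′ ⊆ S × T′ ⊆ T × ∣ S′ ∣ ≤ length Ds * N × ∣ T′ ∣ ≤ length Ds * N ×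
                             (∀ {D} → D ∈ˡ Ds → Reducible G D K b S T S′ T′))
  collect [] _ = ⊥ , ⊥ , (λ x∈ → contradiction x∈ ∉⊥) , (λ x∈ → contradiction x∈ ∉⊥) ,
    ℕ.≤-reflexive (∣⊥∣≡0 n) , ℕ.≤-reflexive (∣⊥∣≡0 n) , λ ()
  collect {S = S} {T} (D ∷ Ds) kernel with collect Ds (λ D∈ → kernel (there D∈)) | kernel (here refl)
  ... | S₂ , T₂ , S₂⊆ , T₂⊆ , ∣S₂∣ , ∣T₂∣ , red | k =
    S′ ∪ S₂ , T′ ∪ T₂ , ∪⊆ S′⊆S S₂⊆ , ∪⊆ T′⊆T T₂⊆ ,
    ℕ.≤-trans (∣p∪q∣≤∣p∣+∣q∣ S′ S₂) (ℕ.+-mono-≤ ∣S′∣≤ ∣S₂∣) ,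
    ℕ.≤-trans (∣p∪q∣≤∣p∣+∣q∣ T′ T₂) (ℕ.+-mono-≤ ∣T′∣≤ ∣T₂∣) ,
    λ { (here refl) → Reducible-mono G (p⊆p∪q S₂) (p⊆p∪q T₂) reducible
      ; (there D∈)  → Reducible-mono G (q⊆p∪q S′ S₂) (q⊆p∪q T′ T₂) (red D∈) }
    where
    open Kernel k
    ∪⊆ : ∀ {p q r : Subset n} → p ⊆ r → q ⊆ r → p ∪ q ⊆ r
    ∪⊆ {p} {q} p⊆ q⊆ x∈ with x∈p∪q⁻ p q x∈
    ... | inj₁ x∈p = p⊆ x∈p
    ... | inj₂ x∈q = q⊆ x∈q

  module _ {N : ℕ} {K S T A : Subset n} {k b : ℕ} (disj : Disjoint K A) (∣K∣≤ : ∣ K ∣ ≤ k)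
           (kernel : ∀ {D} → D ∈ˡ cc G A → Kernel G N S T D K b) where

    private
      bad? : U.Decidable (λ D → ¬ Good K S T D)
      bad? D = ¬? (good? K S T D)

      bads : List (Subset n)
      bads = filter bad? (cc G A)

      bads⊆ : bads ⊆ˡ cc G A
      bads⊆ D∈ = proj₁ (∈-filter⁻ bad? D∈)

      id⊑ : ∀ {c : Colouring (suc n)} → id ⊑ c
      id⊑ {c} = ⊑⁺ (cong c)

      -- Reducibility would trade an optimal solution for the reduced labels for one with the full
      -- labels, which makes `D` good.
      bad-hub : ∀ {D S′ T′} → D ∈ˡ bads → Reducible G D K b S T S′ T′ →
                ∀ {V} → Solution G (hub K) K S′ T′ D V → ¬ Near G D V 0
      bad-hub {D} D∈ r {V} s opt
        with reduce r
               (Discrete-mergeAll (star K) Discrete-id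
                 (λ x∈ x∈K → disj x∈K (subset (cc-closed (bads⊆ D∈)) x∈)) star-within)
               s (λ Y Y⊆ i → ℕ.≤-trans (opt Y Y⊆ i) (ℕ.+-monoʳ-≤ ∣ V ∣ z≤n))
      ... | W , t , V≤W = proj₂ (∈-filter⁻ bad? {xs = cc G A} D∈)
        (W , t , λ Y Y⊆ i → ℕ.≤-trans (opt Y Y⊆ i) (ℕ.+-monoˡ-≤ 0 V≤W))

    -- With at most `b + k` bad components their labels suffice, as good ones need none. With more,
    -- the labels of `b + k + 1` of them admit no near-optimal solution by `rank`, since `star K`
    -- has at most `k` edges.
    Kernel-cc : Kernel G (suc (b + k) * N) S T A K b
    Kernel-cc with length bads ℕ.≤? b + k
    ... | yes few with collect bads (λ D∈ → kernel (bads⊆ D∈))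
    ...   | S′ , T′ , S′⊆ , T′⊆ , ∣S′∣ , ∣T′∣ , red = record
      { S′⊆S = S′⊆ ; T′⊆T = T′⊆
      ; ∣S′∣≤ = ℕ.≤-trans ∣S′∣ (ℕ.*-monoˡ-≤ N (ℕ.m≤n⇒m≤1+n few))
      ; ∣T′∣≤ = ℕ.≤-trans ∣T′∣ (ℕ.*-monoˡ-≤ N (ℕ.m≤n⇒m≤1+n few))
      ; reducible = record { reduce = λ discrete s near →
          replace (cc G A) (All.tabulate cc-closed) (cc-disjoint A) disj
            (λ x∈ → _ , ∈-cc⁺ G x∈ , ∈-component⁺ G (Joined-refl G x∈))
            (All.tabulate part) discrete s near } }
      where
      part : ∀ {D} → D ∈ˡ cc G A → Good K S T D ⊎ Reducible G D K b S T S′ T′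
      part {D} D∈ with good? K S T D
      ... | yes good = inj₁ good
      ... | no ¬good = inj₂ (red (∈-filter⁺ bad? D∈ ¬good))
    Kernel-cc | no many with collect (take (suc (b + k)) bads) (λ D∈ → kernel (bads⊆ (∈-take D∈)))
      where
      ∈-take : ∀ {D} → D ∈ˡ take (suc (b + k)) bads → D ∈ˡ bads
      ∈-take D∈ = subst (_ ∈ˡ_) (take++drop≡id (suc (b + k)) bads) (∈-++⁺ˡ D∈)
    ... | S′ , T′ , S′⊆ , T′⊆ , ∣S′∣ , ∣T′∣ , red = record
      { S′⊆S = S′⊆ ; T′⊆T = T′⊆
      ; ∣S′∣≤ = subst (λ l → ∣ S′ ∣ ≤ l * N) len ∣S′∣
      ; ∣T′∣≤ = subst (λ l → ∣ T′ ∣ ≤ l * N) len ∣T′∣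
      ; reducible = record { reduce = λ {c} discrete s near → ⊥-elim (infeasible s near) } }
      where
      chosen : List (Subset n)
      chosen = take (suc (b + k)) bads

      len : length chosen ≡ suc (b + k)
      len = trans (length-take (suc (b + k)) bads) (ℕ.m≤n⇒m⊓n≡m (ℕ.≰⇒> many))

      chosen⊆ : chosen ⊆ˡ bads
      chosen⊆ D∈ = subst (_ ∈ˡ_) (take++drop≡id (suc (b + k)) bads) (∈-++⁺ˡ D∈)

      -- Independence over `mergeAll c (star K)` implies independence over `hub K`, so badness
      -- carries over to the context `c`.
      infeasible : ∀ {c W} → Solution G c K S′ T′ A W → ¬ Near G A W b
      infeasible {c} s near = ℕ.1+n≰n (ℕ.≤-trans (subst (_≤ b + length (star K)) len
        (rank chosen (star K) (All.tabulate (λ D∈ → cc-closed (bads⊆ (chosen⊆ D∈))))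
          (AllPairs.take⁺ (suc (b + k)) (AllPairs.filter⁺ bad? (cc-disjoint A))) disj s near
          (All.tabulate λ D∈ t → bad-hub (chosen⊆ D∈) (red D∈)
            (Solution-restrict (λ x∈ → x∈) (inside-C t) t
              (Indep-anti (mergeAll-mono {es = star K} {fs = star K} id⊑ (λ e∈ → e∈)) (acyclic t))))))
        (ℕ.+-monoʳ-≤ b (ℕ.≤-trans (length-star K) ∣K∣≤)))

Comps : Class → Class
Comps 𝒞 G T A = ∀ {D} → D ∈ˡ cc G A → 𝒞 G T D

Bounded-Comps : ∀ {𝒞 : Class} → Bounded 𝒞 → Bounded (Comps 𝒞)
Bounded-Comps f k b with f k b
... | N , kernel = suc (b + k) * N , λ G S T A K p disj k≤ →
  Kernel-cc G disj k≤ λ {D} D∈ →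
    kernel G S T D K (p D∈) (λ x∈K x∈D → disj x∈K (subset (cc-closed G D∈) x∈D)) k≤

-- Packing subtrees versus cutting a forest

module _ {n : ℕ} (G : Graph n) where

  open Graph G

  Joined-mono : ∀ {A B u v} → A ⊆ B → Joined G A u v → Joined G B u v
  Joined-mono A⊆B (u∈ , v∈ , p) = A⊆B u∈ , A⊆B v∈ , gmap id (λ (x∈ , y∈ , a) → A⊆B x∈ , A⊆B y∈ , a) p

  HasPair : Subset n → Subset n → Set
  HasPair T A = ∃[ u ] ∃[ v ] (u ∈ T × v ∈ T × u ≢ v × Joined G A u v)

  HasPair-mono : ∀ {T A B} → A ⊆ B → HasPair T A → HasPair T B
  HasPair-mono A⊆B (u , v , u∈ , v∈ , u≢v , j) = u , v , u∈ , v∈ , u≢v , Joined-mono A⊆B j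

  hasPair? : ∀ T A → Dec (HasPair T A)
  hasPair? T A = any? λ u → any? λ v → (u ∈? T) ×-dec (v ∈? T) ×-dec ¬? (u ≟ v) ×-dec joined? G A u v

  Acyclic : Subset n → Set
  Acyclic C = Indep id (edges G ⊥ ⊥ C)

  Acyclic-⊆ : ∀ {A B} → A ⊆ B → Acyclic B → Acyclic A
  Acyclic-⊆ A⊆B = Indep-edges-anti G (λ x∈ → x∈) (λ x∈ → x∈) A⊆B

  forest⇒acyclic : ∀ {A} → Forest G A → Acyclic A
  forest⇒acyclic forest = forest⇒indep G forest λ u∈ → contradiction u∈ ∉⊥

  -- Seen from the rest of the forest F, H is a union of subtrees below r.
  record Rooted (F : Subset n) (r : Fin n) (H : Subset n) : Set where
    field
      root∈ : r ∈ H
      sub   : H ⊆ F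
      exit  : ∀ {y z} → y ∈ H → z ∈ F → Adj y z → z ∉ H → y ≡ r
  open Rooted

  -- While `H - r` contains a pair, descend to the component `J` of that pair. Acyclicity leaves `r`
  -- at most one neighbour in `J`, which becomes the new root.
  lowest-pair : ∀ {F T} → Acyclic F → ∀ {r H} → Acc _⊂_ H → Rooted F r H → HasPair T H →
                ∃[ r′ ] ∃[ H′ ] (Rooted F r′ H′ × HasPair T H′ × ¬ HasPair T (H′ - r′))
  lowest-pair {F} {T} acyc {r} {H} (acc rs) rooted pair with hasPair? T (H - r)
  ... | no ¬pair = r , H , rooted , pair , ¬pair
  ... | yes (u , v , u∈T , v∈T , u≢v , j@(u∈ , _)) with any? (λ z → (z ∈? J) ×-dec adj? r z)
    where
    J : Subset n
    J = component G (H - r) u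
  ...   | found = descend found
    where
    J : Subset n
    J = component G (H - r) u

    J-closed : ClosedIn G (H - r) J
    J-closed = component-closed G {u = u}

    u∈J : u ∈ J
    u∈J = ∈-component⁺ G (Joined-refl G u∈)

    J⊆ : J ⊆ H - r
    J⊆ = subset J-closed

    J⊆F : J ⊆ F
    J⊆F x∈ = sub rooted (p─q⊆p H _ (J⊆ x∈))

    J⊂H : J ⊂ H
    J⊂H = (λ x∈ → p─q⊆p H _ (J⊆ x∈)) , r , root∈ rooted , λ r∈ → x∉p-x H (J⊆ r∈)

    J-pair : HasPair T J
    J-pair = u , v , u∈T , v∈T , u≢v , Joined-closed G J-closed j u∈J

    -- An edge of `F` leaving `J` must end in `r`: elsewhere in `H` it would stay in the component,
    -- and `H` can be left only from its root.
    inner : ∀ {y z} → y ∈ J → z ∈ F → Adj y z → z ∉ J → Adj r y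
    inner {y} {z} y∈ z∈ a z∉ with z ∈? H | z ≟ r
    ... | _       | yes refl = adj-sym a
    ... | yes z∈H | no z≢r   = contradiction (closed J-closed y∈ (x∈p∧x≢y⇒x∈p-y z∈H z≢r) a) z∉
    ... | no z∉H  | no _     =
      contradiction (exit rooted (p─q⊆p H _ (J⊆ y∈)) z∈ a z∉H) (x∈p-y⇒x≢y H (J⊆ y∈))

    joined : ∀ {y z} → y ∈ J → z ∈ J → Joined G (F - r) y z
    joined y∈ z∈ = Joined-mono (λ x∈ → x∈p∧x≢y⇒x∈p-y (sub rooted (p─q⊆p H _ x∈)) (x∈p-y⇒x≢y H x∈))
      (Joined-trans G (Joined-sym G (∈-component⁻ G {v = u} y∈)) (∈-component⁻ G {v = u} z∈))

    descend : Dec (∃[ z ] (z ∈ J × Adj r z)) →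
              ∃[ r′ ] ∃[ H′ ] (Rooted F r′ H′ × HasPair T H′ × ¬ HasPair T (H′ - r′))
    descend (yes (z , z∈ , rz)) = lowest-pair acyc (rs J⊂H) record
      { root∈ = z∈ ; sub = J⊆F
      ; exit  = λ y∈ w∈ a w∉ →
          unique-neighbour G acyc (sub rooted (root∈ rooted)) (inner y∈ w∈ a w∉) rz (joined y∈ z∈) } J-pair
    -- No edge of `F` leaves `J`, so any of its vertices can serve as root.
    descend (no none) = lowest-pair acyc (rs J⊂H) record
      { root∈ = u∈J ; sub = J⊆F
      ; exit  = λ y∈ w∈ a w∉ → contradiction (_ , y∈ , inner y∈ w∈ a w∉) none } J-pair

  ∣∩∣< : ∀ {H F W : Subset n} → H ⊆ F → H ⊈ W → ∣ F ∩ W ∣ < ∣ F ∣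
  ∣∩∣< {H} {F} {W} H⊆F H⊈W with ⊈⇒∃ H⊈W
  ... | x , x∈H , x∉W = p⊂q⇒∣p∣<∣q∣ (p∩q⊆p F W , x , H⊆F x∈H , λ x∈ → x∉W (p∩q⊆q F W x∈))

  -- An Erdős-Pósa duality, by induction on `b`: cut off a lowest `H` with a pair and apply the
  -- induction to `F ─ H`. A packing there gains the pair of `H`; a cut there gains the root `r`. A
  -- packing is recorded by its consequence that `W` misses more than `b` vertices.
  packing-or-cut : ∀ b {F} T → Acyclic F →
    (∃[ T′ ] (T′ ⊆ T × ∣ T′ ∣ ≤ suc b * 2 × (∀ W → Indep id (edges G ⊥ T′ W) → ∣ F ∩ W ∣ + b < ∣ F ∣)))
    ⊎ (∃[ B ] (∣ B ∣ ≤ b × ¬ HasPair T (F ─ B)))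
  packing-or-cut b {F} T acyc with hasPair? T F
  ... | no ¬pair = inj₂ (⊥ , ℕ.≤-trans (ℕ.≤-reflexive (∣⊥∣≡0 n)) z≤n , λ p → ¬pair (HasPair-mono (p─q⊆p F ⊥) p))
  ... | yes (u , v , u∈T , v∈T , u≢v , j@(u∈F , _))
    with lowest-pair {T = T} acyc (⊂-wellFounded _) start
           (u , v , u∈T , v∈T , u≢v ,
            Joined-closed G (component-closed G {u = u}) j (∈-component⁺ G (Joined-refl G u∈F)))
    where
    start : Rooted F u (component G F u)
    start = record
      { root∈ = ∈-component⁺ G (Joined-refl G u∈F)
      ; sub   = subset (component-closed G {u = u})
      ; exit  = λ y∈ z∈ a z∉ → contradiction (closed (component-closed G {u = u}) y∈ z∈ a) z∉ }
  ...   | r , H , rooted , (x , y , x∈T , y∈T , x≢y , xy) , ¬pair = extend b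
    where
    T₂ : Subset n
    T₂ = ⁅ x ⁆ ∪ ⁅ y ⁆

    T₂⊆T : T₂ ⊆ T
    T₂⊆T z∈ with x∈p∪q⁻ ⁅ x ⁆ ⁅ y ⁆ z∈
    ... | inj₁ z∈x with refl ← x∈⁅y⁆⇒x≡y x z∈x = x∈T
    ... | inj₂ z∈y with refl ← x∈⁅y⁆⇒x≡y y z∈y = y∈T

    ∣T₂∣≤2 : ∣ T₂ ∣ ≤ 2
    ∣T₂∣≤2 = ℕ.≤-trans (∣p∪q∣≤∣p∣+∣q∣ ⁅ x ⁆ ⁅ y ⁆)
      (ℕ.+-mono-≤ (ℕ.≤-reflexive (∣⁅x⁆∣≡1 x)) (ℕ.≤-reflexive (∣⁅x⁆∣≡1 y)))

    hit : ∀ {T′ W} → T₂ ⊆ T′ → Indep id (edges G ⊥ T′ W) → H ⊈ W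
    hit T₂⊆ i H⊆W = x≢y (T-separated G i (T₂⊆ (p⊆p∪q _ (x∈⁅x⁆ x))) (T₂⊆ (q⊆p∪q ⁅ x ⁆ _ (x∈⁅x⁆ y)))
                      (Joined-mono H⊆W xy))

    extend : ∀ b →
      (∃[ T′ ] (T′ ⊆ T × ∣ T′ ∣ ≤ suc b * 2 × (∀ W → Indep id (edges G ⊥ T′ W) → ∣ F ∩ W ∣ + b < ∣ F ∣)))
      ⊎ (∃[ B ] (∣ B ∣ ≤ b × ¬ HasPair T (F ─ B)))
    -- For slack 0 the single pair in `H` is already a packing.
    extend zero = inj₁ (T₂ , T₂⊆T , ∣T₂∣≤2 , λ W i →
      subst (_< ∣ F ∣) (sym (ℕ.+-identityʳ _)) (∣∩∣< (sub rooted) (hit (λ z∈ → z∈) i)))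
    extend (suc b) with packing-or-cut b T (Acyclic-⊆ (p─q⊆p F H) acyc)
    ... | inj₁ (T₁ , T₁⊆T , ∣T₁∣ , packed) = inj₁ (T₂ ∪ T₁ , T₂∪T₁⊆T ,
        ℕ.≤-trans (∣p∪q∣≤∣p∣+∣q∣ T₂ T₁) (ℕ.+-mono-≤ ∣T₂∣≤2 ∣T₁∣) , missed)
      where
      T₂∪T₁⊆T : T₂ ∪ T₁ ⊆ T
      T₂∪T₁⊆T z∈ with x∈p∪q⁻ T₂ T₁ z∈
      ... | inj₁ z∈₂ = T₂⊆T z∈₂
      ... | inj₂ z∈₁ = T₁⊆T z∈₁

      -- `W` misses a vertex of `H` and, by induction, more than `b` vertices of `F ─ H`.
      missed : ∀ W → Indep id (edges G ⊥ (T₂ ∪ T₁) W) → ∣ F ∩ W ∣ + suc b < ∣ F ∣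
      missed W i = begin
        suc (∣ F ∩ W ∣ + suc b)                               ≡⟨ cong suc (ℕ.+-suc _ b) ⟩
        2 + (∣ F ∩ W ∣ + b)                                   ≡⟨ cong (λ z → 2 + (z + b)) (∣split∣ (split-∩─ (F ∩ W) H)) ⟩
        2 + (∣ (F ∩ W) ∩ H ∣ + ∣ (F ∩ W) ─ H ∣ + b)           ≤⟨ ℕ.+-monoʳ-≤ 2 (ℕ.+-monoˡ-≤ b parts) ⟩
        2 + (∣ H ∩ W ∣ + ∣ (F ─ H) ∩ W ∣ + b)                 ≡⟨ cong (2 +_) (ℕ.+-assoc ∣ H ∩ W ∣ _ b) ⟩
        2 + (∣ H ∩ W ∣ + (∣ (F ─ H) ∩ W ∣ + b))               ≡⟨ cong suc (ℕ.+-suc ∣ H ∩ W ∣ _) ⟨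
        suc ∣ H ∩ W ∣ + suc (∣ (F ─ H) ∩ W ∣ + b)             ≤⟨ ℕ.+-mono-≤ (∣∩∣< (λ z∈ → z∈) (hit (p⊆p∪q T₁) i)) (packed W i₁) ⟩
        ∣ H ∣ + ∣ F ─ H ∣                                     ≤⟨ ℕ.+-monoˡ-≤ ∣ F ─ H ∣ (p⊆q⇒∣p∣≤∣q∣ (λ z∈ → x∈p∩q⁺ (sub rooted z∈ , z∈))) ⟩
        ∣ F ∩ H ∣ + ∣ F ─ H ∣                                 ≡⟨ ∣split∣ (split-∩─ F H) ⟨
        ∣ F ∣                                                 ∎
        where
        open ℕ.≤-Reasoning
        i₁ : Indep id (edges G ⊥ T₁ W)
        i₁ = Indep-edges-anti G (λ z∈ → z∈) (q⊆p∪q T₂ T₁) (λ z∈ → z∈) i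
        ∩⊆ : (F ∩ W) ∩ H ⊆ H ∩ W
        ∩⊆ z∈ = x∈p∩q⁺ (p∩q⊆q (F ∩ W) H z∈ , p∩q⊆q F W (p∩q⊆p (F ∩ W) H z∈))
        ─⊆ : (F ∩ W) ─ H ⊆ (F ─ H) ∩ W
        ─⊆ z∈ = x∈p∩q⁺ (x∈p∧x∉q⇒x∈p─q (p∩q⊆p F W (p─q⊆p (F ∩ W) H z∈)) (x∈p─q⇒x∉q (F ∩ W) H z∈)
                       , p∩q⊆q F W (p─q⊆p (F ∩ W) H z∈))
        parts : ∣ (F ∩ W) ∩ H ∣ + ∣ (F ∩ W) ─ H ∣ ≤ ∣ H ∩ W ∣ + ∣ (F ─ H) ∩ W ∣
        parts = ℕ.+-mono-≤ (p⊆q⇒∣p∣≤∣q∣ ∩⊆) (p⊆q⇒∣p∣≤∣q∣ ─⊆)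
    ... | inj₂ (B , ∣B∣ , ¬pair′) = inj₂ (⁅ r ⁆ ∪ B ,
        ℕ.≤-trans (∣p∪q∣≤∣p∣+∣q∣ ⁅ r ⁆ B) (ℕ.+-mono-≤ (ℕ.≤-reflexive (∣⁅x⁆∣≡1 r)) ∣B∣) , separated)
      where
      A : Subset n
      A = F ─ (⁅ r ⁆ ∪ B)

      A⊆F : A ⊆ F
      A⊆F = p─q⊆p F (⁅ r ⁆ ∪ B)

      ≢r : ∀ {z} → z ∈ A → z ≢ r
      ≢r z∈ refl = x∈p─q⇒x∉q F (⁅ r ⁆ ∪ B) z∈ (p⊆p∪q B (x∈⁅x⁆ r))

      -- With `r` removed no edge runs between `H` and the rest, so a joined pair lies on one side.
      below : ClosedIn G A (A ∩ H)
      below = record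
        { subset = p∩q⊆p A H
        ; closed = λ {y} {z} y∈ z∈ a → x∈p∩q⁺ (z∈ , stay y∈ z∈ a) }
        where
        stay : ∀ {y z} → y ∈ A ∩ H → z ∈ A → Adj y z → z ∈ H
        stay {y} {z} y∈ z∈ a with z ∈? H
        ... | yes z∈H = z∈H
        ... | no z∉H  = contradiction (exit rooted (p∩q⊆q A H y∈) (A⊆F z∈) a z∉H) (≢r (p∩q⊆p A H y∈))

      above : ClosedIn G A (A ─ H)
      above = record
        { subset = p─q⊆p A H
        ; closed = λ {y} {z} y∈ z∈ a → x∈p∧x∉q⇒x∈p─q z∈ λ z∈H →
            ≢r z∈ (exit rooted z∈H (A⊆F (p─q⊆p A H y∈)) (adj-sym a) (x∈p─q⇒x∉q A H y∈)) }

      separated : ¬ HasPair T A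
      separated (s , t , s∈T , t∈T , s≢t , j@(s∈A , _)) with s ∈? H
      ... | yes s∈H = ¬pair (s , t , s∈T , t∈T , s≢t ,
        Joined-mono (λ z∈ → x∈p∧x≢y⇒x∈p-y (p∩q⊆q A H z∈) (≢r (p∩q⊆p A H z∈)))
          (Joined-closed G below j (x∈p∩q⁺ (s∈A , s∈H))))
      ... | no s∉H = ¬pair′ (s , t , s∈T , t∈T , s≢t ,
        Joined-mono (λ z∈ → x∈p∧x∉q⇒x∈p─q (x∈p∧x∉q⇒x∈p─q (A⊆F (p─q⊆p A H z∈)) (x∈p─q⇒x∉q A H z∈))
            (λ z∈B → x∈p─q⇒x∉q F (⁅ r ⁆ ∪ B) (p─q⊆p A H z∈) (q⊆p∪q ⁅ r ⁆ B z∈B)))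
          (Joined-closed G above j (x∈p∧x∉q⇒x∈p─q s∈A s∉H)))

-- Bounded kernels for forests

subset-of-size : ∀ (p : Subset n) m → m ≤ ∣ p ∣ → ∃[ q ] (q ⊆ p × ∣ q ∣ ≡ m)
subset-of-size {n} p zero _ = ⊥ , (λ x∈ → contradiction x∈ ∉⊥) , ∣⊥∣≡0 n
subset-of-size (outside ∷ p) (suc m) m≤ with subset-of-size p (suc m) m≤
... | q , q⊆p , eq = outside ∷ q , out⊆out q⊆p , eq
  where
  out⊆out : ∀ {q} → q ⊆ p → outside ∷ q ⊆ outside ∷ p
  out⊆out q⊆p (there x∈) = there (q⊆p x∈)
subset-of-size (inside ∷ p) (suc m) (s≤s m≤) with subset-of-size p m m≤
... | q , q⊆p , eq = inside ∷ q , in⊆in′ q⊆p , cong suc eq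
  where
  in⊆in′ : ∀ {q} → q ⊆ p → inside ∷ q ⊆ inside ∷ p
  in⊆in′ q⊆p here       = here
  in⊆in′ q⊆p (there x∈) = there (q⊆p x∈)

∣p∣≤1 : ∀ {p : Subset n} → (∀ {x y} → x ∈ p → y ∈ p → x ≡ y) → ∣ p ∣ ≤ 1
∣p∣≤1 {n} {p} eq with any? (_∈? p)
... | yes (x , x∈) = subst (∣ p ∣ ≤_) (∣⁅x⁆∣≡1 x)
  (p⊆q⇒∣p∣≤∣q∣ λ y∈ → subst (_∈ ⁅ x ⁆) (eq x∈ y∈) (x∈⁅x⁆ x))
... | no none = ℕ.≤-trans (p⊆q⇒∣p∣≤∣q∣ {q = ⊥} (λ x∈ → contradiction (_ , x∈) none))
                  (ℕ.≤-trans (ℕ.≤-reflexive (∣⊥∣≡0 n)) z≤n)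

Thin : Class
Thin G T C = Acyclic G C × (∀ {u v} → u ∈ T ∩ C → v ∈ T ∩ C → u ≡ v)

-- `C` itself is acyclic, so a near-optimal `W` misses at most `b` of its vertices. Hence `b + 1`
-- labels of `S` cannot be satisfied, and fewer are kept entirely.
Bounded-Thin : Bounded Thin
Bounded-Thin k b = suc b , kernel
  where
  module _ {n : ℕ} (G : Graph n) (S T C K : Subset n) (thin : Thin G T C) where
    with-S : ∀ S′ → S′ ⊆ S → ∣ S′ ∣ ≤ suc b → Reducible G C K b S T S′ (T ∩ C) → Kernel G (suc b) S T C K b
    with-S S′ S′⊆S ∣S′∣≤ red = record
      { S′⊆S = S′⊆S ; T′⊆T = p∩q⊆p T C ; ∣S′∣≤ = ∣S′∣≤
      ; ∣T′∣≤ = ℕ.≤-trans (∣p∣≤1 (proj₂ thin)) (s≤s z≤n) ; reducible = red }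

    all-S : Reducible G C K b S T (S ∩ C) (T ∩ C)
    reduce all-S _ {W} s _ = W , record
      { inside-C = inside-C s
      ; avoids   = λ x∈S x∈W → avoids s (x∈p∩q⁺ (x∈S , inside-C s x∈W)) x∈W
      ; acyclic  = Indep-relabel G (λ x∈W x∈T → x∈p∩q⁺ (x∈T , inside-C s x∈W)) (acyclic s) } , ℕ.≤-refl

    many-S : ∀ {S′} → S′ ⊆ S ∩ C → ∣ S′ ∣ ≡ suc b → Reducible G C K b S T S′ (T ∩ C)
    reduce (many-S {S′} S′⊆ ∣S′∣) _ {W} s near = contradiction (begin
      ∣ W ∣ + suc b         ≡⟨ ℕ.+-comm ∣ W ∣ (suc b) ⟩
      suc b + ∣ W ∣         ≡⟨ cong (_+ ∣ W ∣) ∣S′∣ ⟨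
      ∣ S′ ∣ + ∣ W ∣        ≤⟨ ℕ.+-mono-≤ (p⊆q⇒∣p∣≤∣q∣ (λ x∈ → x∈p∩q⁺ (p∩q⊆q S C (S′⊆ x∈) , x∈)))
                                (p⊆q⇒∣p∣≤∣q∣ (λ x∈ → x∈p∧x∉q⇒x∈p─q (inside-C s x∈) (λ x∈S′ → avoids s x∈S′ x∈))) ⟩
      ∣ C ∩ S′ ∣ + ∣ C ─ S′ ∣ ≡⟨ ∣split∣ (split-∩─ C S′) ⟨
      ∣ C ∣                 ≤⟨ near C (λ x∈ → x∈) (proj₁ thin) ⟩
      ∣ W ∣ + b             ∎) (ℕ.<⇒≱ (ℕ.+-monoʳ-< ∣ W ∣ (ℕ.n<1+n b)))
      where open ℕ.≤-Reasoning

    kernel : Disjoint K C → ∣ K ∣ ≤ k → Kernel G (suc b) S T C K b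
    kernel _ _ with suc b ℕ.≤? ∣ S ∩ C ∣
    ... | no few = with-S (S ∩ C) (p∩q⊆p S C) (ℕ.<⇒≤ (ℕ.≰⇒> few)) all-S
    ... | yes many with subset-of-size (S ∩ C) (suc b) many
    ...   | S′ , S′⊆ , eq = with-S S′ (λ x∈ → p∩q⊆p S C (S′⊆ x∈)) (ℕ.≤-reflexive eq) (many-S S′⊆ eq)

CutBy : ℕ → Class
CutBy j G T C = Acyclic G C × ∃[ B ] (∣ B ∣ ≤ j × ¬ HasPair G T (C ─ B))

cut⇒thin : ∀ (G : Graph n) T C → CutBy 0 G T C → Comps Thin G T C
cut⇒thin G T C (acyc , B , ∣B∣≤0 , ¬pair) {D} D∈ = Acyclic-⊆ G D⊆C acyc , one
  where
  D⊆C : D ⊆ C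
  D⊆C = subset (cc-closed G D∈)

  D⊆C─B : D ⊆ C ─ B
  D⊆C─B x∈ = x∈p∧x∉q⇒x∈p─q (D⊆C x∈) λ x∈B →
    contradiction (ℕ.≤-trans (x∈p⇒∣p-x∣<∣p∣ x∈B) ∣B∣≤0) λ ()

  one : ∀ {u v} → u ∈ T ∩ D → v ∈ T ∩ D → u ≡ v
  one {u} {v} u∈ v∈ with u ≟ v
  ... | yes eq = eq
  ... | no u≢v = contradiction (u , v , p∩q⊆p T D u∈ , p∩q⊆p T D v∈ , u≢v ,
    Joined-mono G D⊆C─B (cc-joined G D∈ (p∩q⊆q T D u∈) (p∩q⊆q T D v∈))) ¬pair

-- Delete a vertex of the cut that lies in `C`; if there is none, the empty cut separates as well.
cut-step : ∀ j (G : Graph n) T C → CutBy (suc j) G T C → (CutBy j ∪ᶜ Vertex (CutBy j)) G T C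
cut-step {n} j G T C (acyc , B , ∣B∣≤ , ¬pair) with any? (λ x → (x ∈? B) ×-dec (x ∈? C))
... | yes (x , x∈B , x∈C) = inj₂ (x , x∈C , Acyclic-⊆ G (p─q⊆p C _) acyc , B - x ,
  ℕ.≤-pred (ℕ.≤-trans (x∈p⇒∣p-x∣<∣p∣ x∈B) ∣B∣≤) , λ p → ¬pair (HasPair-mono G below p))
  where
  below : (C - x) ─ (B - x) ⊆ C ─ B
  below y∈ = x∈p∧x∉q⇒x∈p─q (p─q⊆p C _ (p─q⊆p (C - x) _ y∈)) λ y∈B →
    x∈p─q⇒x∉q (C - x) (B - x) y∈ (x∈p∧x≢y⇒x∈p-y y∈B (x∈p-y⇒x≢y C (p─q⊆p (C - x) _ y∈)))
... | no none =
  inj₁ (acyc , ⊥ , ℕ.≤-trans (ℕ.≤-reflexive (∣⊥∣≡0 n)) z≤n , λ p → ¬pair (HasPair-mono G below p))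
  where
  below : C ─ ⊥ ⊆ C ─ B
  below y∈ = x∈p∧x∉q⇒x∈p─q (p─q⊆p C ⊥ y∈) λ y∈B → none (_ , y∈B , p─q⊆p C ⊥ y∈)

Bounded-CutBy : ∀ j → Bounded (CutBy j)
Bounded-CutBy zero    = Bounded-⊆ {𝒞 = Comps Thin} cut⇒thin (Bounded-Comps Bounded-Thin)
Bounded-CutBy (suc j) = Bounded-⊆ {𝒞 = CutBy j ∪ᶜ Vertex (CutBy j)} (cut-step j)
  (Bounded-∪ (Bounded-CutBy j) (Bounded-Vertex (Bounded-CutBy j)))

AcyclicClass : Class
AcyclicClass G _ C = Acyclic G C

-- A packing makes `W` miss more than `b` vertices of the acyclic `C`, so its labels admit no
-- near-optimal solution. A cut has at most `b` vertices.
Bounded-acyclic : Bounded AcyclicClass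
Bounded-acyclic k b with Bounded-CutBy b k b
... | N , cut-kernel = suc b * 2 + N , kernel
  where
  kernel : ∀ {n} (G : Graph n) S T C K → Acyclic G C → Disjoint K C → ∣ K ∣ ≤ k →
           Kernel G (suc b * 2 + N) S T C K b
  kernel {n} G S T C K acyc disj k≤ with packing-or-cut G b T acyc
  ... | inj₂ cut = Kernel-≤ G (ℕ.m≤n+m N (suc b * 2)) (cut-kernel G S T C K (acyc , cut) disj k≤)
  ... | inj₁ (T′ , T′⊆T , ∣T′∣ , packed) = Kernel-≤ G (ℕ.m≤m+n (suc b * 2) N) record
    { S′⊆S = λ x∈ → contradiction x∈ ∉⊥ ; T′⊆T = T′⊆T
    ; ∣S′∣≤ = ℕ.≤-trans (ℕ.≤-reflexive (∣⊥∣≡0 n)) z≤n ; ∣T′∣≤ = ∣T′∣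
    ; reducible = record { reduce = λ _ {W} s near → contradiction
        (ℕ.≤-trans (near C (λ x∈ → x∈) acyc)
          (ℕ.+-monoˡ-≤ b (p⊆q⇒∣p∣≤∣q∣ (λ x∈ → x∈p∩q⁺ (inside-C s x∈ , x∈)))))
        (ℕ.<⇒≱ (packed W (acyclic-id G s))) } }

-- Classes following the elimination distance

-- Mirrors the clauses of `ed`: `EdConn` covers forests and the deletion of a vertex, `EdClass` adds
-- the passage to components. Components are connected, so one such passage between deletions
-- suffices.
EdConn EdClass : ℕ → Class
EdConn zero      = AcyclicClass
EdConn (suc η)   = AcyclicClass ∪ᶜ Vertex (EdClass η)
EdClass η        = EdConn η ∪ᶜ Comps (EdConn η)

Bounded-EdConn : ∀ η → Bounded (EdConn η)
Bounded-EdClass : ∀ η → Bounded (EdClass η)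
Bounded-EdConn zero    = Bounded-acyclic
Bounded-EdConn (suc η) = Bounded-∪ {AcyclicClass} Bounded-acyclic (Bounded-Vertex (Bounded-EdClass η))
Bounded-EdClass η      = Bounded-∪ {EdConn η} (Bounded-EdConn η) (Bounded-Comps (Bounded-EdConn η))

∈⇒≤maximum : ∀ {x xs} → x ∈ˡ xs → x ≤ maximum xs
∈⇒≤maximum {xs = x ∷ xs} (here refl) = ℕ.m≤m⊔n x (maximum xs)
∈⇒≤maximum {xs = x ∷ xs} (there x∈)  = ℕ.≤-trans (∈⇒≤maximum x∈) (ℕ.m≤n⊔m x (maximum xs))

minimum-attained : ∀ x xs → minimum (x ∷ xs) ∈ˡ x ∷ xs
minimum-attained x [] = here refl
minimum-attained x (y ∷ ys) with ℕ.⊓-sel y (minimum (x ∷ ys)) | minimum-attained x ys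
... | inj₁ eq | _        = there (here eq)
... | inj₂ eq | here eq′ = here (trans eq eq′)
... | inj₂ eq | there y∈ = there (there (subst (_∈ˡ ys) (sym eq) y∈))

module _ {n : ℕ} (G : Graph n) {T : Subset n} where

  cc-connected : ∀ {A D} → D ∈ˡ cc G A → ¬ 1 < length (cc G D)
  cc-connected {A} {D} D∈ 1< = single (cc G D) refl 1<
    where
    single : ∀ Es → Es ≡ cc G D → ¬ 1 < length Es
    single (E ∷ Es) eq 1<
      with another (cc G D) (deduplicate-! (≡-dec Bool._≟_) (map (component G D) (elements D)))
             (subst (λ Es → 1 < length Es) eq 1<) (subst (E ∈ˡ_) eq (here refl))
    ... | E′ , E′∈ , E≢E′ with ∈-cc⁻ G (subst (E ∈ˡ_) eq (here refl)) | ∈-cc⁻ G E′∈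
    ...   | u , u∈ , refl | v , v∈ , refl = E≢E′ (component-cong G (cc-joined G D∈ u∈ v∈))

  acyclic⇒EdConn : ∀ η {A} → Acyclic G A → EdConn η G T A
  acyclic⇒EdConn zero    acyc = acyc
  acyclic⇒EdConn (suc η) acyc = inj₁ acyc

  cheapest : ∀ {A η} → ¬ Forest G A → minimum (map (λ v → ed G (A - v)) (elements A)) ≤ η →
             ∃[ v ] (v ∈ A × ed G (A - v) ≤ η)
  cheapest {A} {η} ¬forest = go (elements A) refl
    where
    go : ∀ vs → vs ≡ elements A → minimum (map (λ v → ed G (A - v)) vs) ≤ η →
         ∃[ v ] (v ∈ A × ed G (A - v) ≤ η)
    -- The junk value of `minimum` on `[]` does not occur: a cycle has a vertex in `A`.
    go [] eq _ = contradiction (λ { (v , _ , _ , v∈ ∷ _ , _) →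
      contradiction (subst (v ∈ˡ_) (sym eq) (∈-elements⁺ v∈)) λ () }) ¬forest
    go (v ∷ vs) eq ≤η
      with ∈-map⁻ (λ v → ed G (A - v)) (minimum-attained (ed G (A - v)) (map (λ v → ed G (A - v)) vs))
    ... | w , w∈ , eq′ = w , ∈-elements⁻ (subst (w ∈ˡ_) eq w∈) , subst (_≤ η) eq′ ≤η

  ed⇒EdConn : ∀ η {A} → ¬ 1 < length (cc G A) → ed G A ≤ η → EdConn η G T A
  ed⇒EdClass : ∀ η {A} → ed G A ≤ η → EdClass η G T A

  ed⇒EdConn η {A} conn ≤η = by-cases η ≤η (forest? G A)
    where
    by-cases : ∀ η → ed G A ≤ η → Dec (Forest G A) → EdConn η G T A
    by-cases η       _  (yes forest) = acyclic⇒EdConn η (forest⇒acyclic G forest)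
    by-cases zero    ≤0 (no ¬forest) = contradiction (subst (_≤ 0) (ed-connected G ¬forest conn) ≤0) λ ()
    by-cases (suc η) ≤η (no ¬forest)
      with cheapest ¬forest (ℕ.≤-pred (subst (_≤ suc η) (ed-connected G ¬forest conn) ≤η))
    ... | v , v∈ , ≤η′ = inj₂ (v , v∈ , ed⇒EdClass η ≤η′)

  ed⇒EdClass η {A} ≤η = by-cases (forest? G A) (1 ℕ.<? length (cc G A))
    where
    by-cases : Dec (Forest G A) → Dec (1 < length (cc G A)) → EdClass η G T A
    by-cases (yes forest) _         = inj₁ (acyclic⇒EdConn η (forest⇒acyclic G forest))
    by-cases (no _)       (no conn) = inj₁ (ed⇒EdConn η conn ≤η)
    by-cases (no ¬forest) (yes 1<)  = inj₂ λ {D} D∈ → ed⇒EdConn η (cc-connected D∈)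
      (ℕ.≤-trans (∈⇒≤maximum (∈-map⁺ (ed G) D∈)) (subst (_≤ η) (ed-disconnected G ¬forest 1<) ≤η))

-- Translation to minimum feedback vertex sets

split-∁ : ∀ (X : Subset n) → IsSplit ⊤ X (∁ X)
split-∁ X = record
  { cover    = λ {x} _ → cover x
  ; left     = λ _ → ∈⊤
  ; right    = λ _ → ∈⊤
  ; disjoint = λ x∈ x∈∁ → x∈∁p⇒x∉p x∈∁ x∈ }
  where
  cover : ∀ x → x ∈ X ⊎ x ∈ ∁ X
  cover x with x ∈? X
  ... | yes x∈ = inj₁ x∈
  ... | no x∉  = inj₂ (x∉p⇒x∈∁p x∉)

∁∁⊆ : ∀ {X : Subset n} → ∁ (∁ X) ⊆ X
∁∁⊆ x∈ = x∉∁p⇒x∈p (x∈∁p⇒x∉p x∈)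

∣∁∣-anti : ∀ (X Y : Subset n) → ∣ X ∣ ≤ ∣ Y ∣ → ∣ ∁ Y ∣ ≤ ∣ ∁ X ∣
∣∁∣-anti {n} X Y X≤Y = ℕ.+-cancelˡ-≤ ∣ X ∣ _ _ (begin
  ∣ X ∣ + ∣ ∁ Y ∣ ≤⟨ ℕ.+-monoˡ-≤ ∣ ∁ Y ∣ X≤Y ⟩
  ∣ Y ∣ + ∣ ∁ Y ∣ ≡⟨ ∣split∣ (split-∁ Y) ⟨
  ∣ ⊤ {n} ∣       ≡⟨ ∣split∣ (split-∁ X) ⟩
  ∣ X ∣ + ∣ ∁ X ∣ ∎)
  where open ℕ.≤-Reasoning

module _ {n : ℕ} (G : Graph n) where

  acyclic⇒FVS : ∀ {Y} → Acyclic G Y → IsFVS G (∁ Y)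
  acyclic⇒FVS acyc = indep⇒forest G (Acyclic-⊆ G ∁∁⊆ acyc)

  -- Complements turn minimum feedback vertex sets into largest acyclic sets, so the slack is 0.
  minFVS⇒near : ∀ {X} → IsMinFVS G X → Near G ⊤ (∁ X) 0
  minFVS⇒near {X} (_ , min) Y _ acyc = begin
    ∣ Y ∣         ≤⟨ p⊆q⇒∣p∣≤∣q∣ {p = Y} {∁ (∁ Y)} (λ x∈ → x∉p⇒x∈∁p (λ x∈∁ → x∈∁p⇒x∉p x∈∁ x∈)) ⟩
    ∣ ∁ (∁ Y) ∣   ≤⟨ ∣∁∣-anti X (∁ Y) (min (∁ Y) (acyclic⇒FVS acyc)) ⟩
    ∣ ∁ X ∣       ≡⟨ ℕ.+-identityʳ _ ⟨
    ∣ ∁ X ∣ + 0   ∎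
    where open ℕ.≤-Reasoning

  joined⇒leavesConnected : ∀ {X T} → HasPair G T (∁ X) → LeavesConnected G X T
  joined⇒leavesConnected (u , v , u∈ , v∈ , u≢v , j@(u∉ , v∉ , _)) =
    u , v , x∈p∧x∉q⇒x∈p─q u∈ (x∈∁p⇒x∉p u∉) , x∈p∧x∉q⇒x∈p─q v∈ (x∈∁p⇒x∉p v∉) , u≢v , j

  module _ {N : ℕ} {S T : Subset n} (kernel : Kernel G N S T ⊤ ⊥ 0)
           (blocked : ∀ X → IsMinFVS G X → S ⊈ X ⊎ LeavesConnected G X T) where

    open Kernel kernel

    -- If `X` contained `S′` and separated `T′`, reducing `∁ X` would give a `W` at least as large
    -- for the full labels. Then `∁ W` is a minimum feedback vertex set that contains `S` and
    -- separates `T`, against `blocked`.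
    kernel-blocked : ∀ X → IsMinFVS G X → S′ ⊈ X ⊎ LeavesConnected G X T′
    kernel-blocked X minFVS@(fvs , min) with S′ ⊆? X | hasPair? G T′ (∁ X)
    ... | no S′⊈X  | _        = inj₁ S′⊈X
    ... | _        | yes pair = inj₂ (joined⇒leavesConnected pair)
    ... | yes S′⊆X | no ¬pair
      with reduce reducible (λ _ eq → eq) solution (minFVS⇒near minFVS)
      where
      separated : ∀ {u v} → u ∈ T′ → v ∈ T′ → Joined G (∁ X) u v → u ≡ v
      separated {u} {v} u∈ v∈ j with u ≟ v
      ... | yes eq = eq
      ... | no u≢v = contradiction (u , v , u∈ , v∈ , u≢v , j) ¬pair

      solution : Solution G id ⊥ S′ T′ ⊤ (∁ X)
      solution = record
        { inside-C = λ _ → ∈⊤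
        ; avoids   = λ x∈ x∈∁ → x∈∁p⇒x∉p x∈∁ (S′⊆X x∈)
        ; acyclic  = forest⇒indep G fvs separated }
    ...   | W , s , ≤W with blocked (∁ W) (acyclic⇒FVS (acyclic-⊥ G s) , λ Y fvs′ → ℕ.≤-trans smaller (min Y fvs′))
      where
      smaller : ∣ ∁ W ∣ ≤ ∣ X ∣
      smaller = ℕ.≤-trans (∣∁∣-anti (∁ X) W ≤W) (p⊆q⇒∣p∣≤∣q∣ {p = ∁ (∁ X)} {X} ∁∁⊆)
    ...     | inj₁ S⊈ = contradiction (λ {x} x∈ → x∉p⇒x∈∁p (avoids s x∈)) S⊈
    ...     | inj₂ (u , v , u∈ , v∈ , u≢v , j) =
      contradiction (T-separated G (acyclic s) (p─q⊆p T _ u∈) (p─q⊆p T _ v∈) (Joined-mono G ∁∁⊆ j)) u≢v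

lemma1 : Σ[ f ∈ (ℕ → ℕ) ]
    (∀ n (G : Graph n) (S T : Subset n) →
    Connected G ⊤ →
    Empty (S ∩ T) →
    (∀ X → IsMinFVS G X → S ⊈ X ⊎ LeavesConnected G X T) →
    ∃[ S* ] ∃[ T* ]
    (S* ⊆ S × T* ⊆ T ×
    ∣ S* ∣ ≤ f (ed G ⊤) × ∣ T* ∣ ≤ f (ed G ⊤) ×
    (∀ X → IsMinFVS G X → S* ⊈ X ⊎ LeavesConnected G X T*)))
-- The whole graph is one piece with no kept vertices and no slack, hence the parameters `0 0`.
lemma1 = (λ η → proj₁ (Bounded-EdClass η 0 0)) , λ n G S T _ _ blocked →
  let kernel = proj₂ (Bounded-EdClass (ed G ⊤) 0 0) G S T ⊤ ⊥ (ed⇒EdClass G (ed G ⊤) ℕ.≤-refl)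
                 (λ x∈ → contradiction x∈ ∉⊥) (ℕ.≤-reflexive (∣⊥∣≡0 n))
      open Kernel kernel
  in S′ , T′ , S′⊆S , T′⊆T , ∣S′∣≤ , ∣T′∣≤ , kernel-blocked G kernel blocked
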